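{- If $\alpha$ is a valid conjunctive formula, then $\emptyset\Vdash\alpha$, i.e. $\Rightarrow\alpha$ has a constructive co-proof.
   Context: Formulas ($\mathsf{L}_\mu$): built from variables $x$ and negated variables $\neg x$ (literals) by $\square$, $\diamond$, $\bigwedge\Gamma$, $\bigvee\Gamma$ ($\Gamma$ finite), $\mu\phi,\nu\phi$ ($\phi=\lambda x.\alpha$, $\neg x$ not in $\alpha$); $\phi\beta:=\alpha[x:=\beta]$; negation $\alpha^\bot$ is the dual formula (swap $x/\neg x$, $\bigwedge/\bigvee$, $\square/\diamond$, $\mu/\nu$, with $(\mu\lambda x.\alpha)^\bot=\nu\lambda x.(\alpha[x:=\neg x])^\bot$). Semantics: standard semantics over tree-shaped Kripke models, $\mu,\nu$ least/greatest fixed points; valid = true at the root of every model. Immediate subformula: $\beta\in\Gamma$ for $\bigwedge\Gamma,\bigvee\Gamma$; $\beta$ for $\square\beta,\diamond\beta$; $\phi(\sigma\phi)$ for $\sigma\phi$. Expanded cover modality $\nabla_L(\Gamma,\Delta):=\bigwedge(L\cup\{\diamond\gamma:\gamma\in\Gamma\}\cup\{\square\bigvee\Delta\})$, $L$ a consistent finite set of literals (never both $x$ and $\neg x$), $\Gamma\subseteq\Delta$ finite. A formula is disjunctive if every (derived) subformula that is a conjunction is such an instance; $\alpha$ is conjunctive if $\alpha^\bot$ is disjunctive. Calculus: exchange, contraction, weakening; ($\bigwedge$L), ($\bigvee$L), ($\sigma$L), ($\diamond$L): $\alpha,\Phi\Rightarrow\Psi$ / $\diamond\alpha,\square\Phi\Rightarrow\diamond\Psi$;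 ($\bigwedge$R), ($\bigvee$R), ($\sigma$R), ($\square$R): $\Phi\Rightarrow\Psi,\alpha$ / $\square\Phi\Rightarrow\diamond\Psi,\square\alpha$; quantifier rules unfold $\sigma\phi$ to $\phi(\sigma\phi)$; axioms $x,\neg x\Rightarrow$; $\Rightarrow\neg x,x$; $x\Rightarrow x$ ($x$ variable). Traces follow formula occurrences upward (principal to minor, side to side) and support threads; an infinite thread is a $\nu$- or $\mu$-thread according to the quantifier of the minimal-complexity formula occurring infinitely often (complexity: literals $0$, each connective/modality/quantifier adds $1$). Co-proof: possibly infinite derivation with axiom leaves, infinitely many logical rules on each infinite branch, each infinite branch carrying a left trace supporting a $\mu$-thread or a right trace supporting a $\nu$-thread. Constructive: every sequent has at most one right formula. $\Phi\Vdash\alpha$: a constructive co-proof of $\Phi\Rightarrow\alpha$ exists. -}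

module Defs where

open import Data.Empty using (⊥)
open import Data.Fin.Base using (Fin; zero; suc)
open import Data.List.Base using (List; []; _∷_; _++_; map; length)
open import Data.List.Membership.Propositional using (_∈_)
open import Data.List.Membership.Propositional.Properties using (∈-map⁺)
open import Data.List.Relation.Binary.BagAndSetEquality using (_∼[_]_; set)
open import Data.List.Relation.Binary.Permutation.Propositional using (_↭_)
open import Data.List.Relation.Binary.Permutation.Propositional.Properties using (∈-resp-↭)
open import Data.List.Relation.Binary.Subset.Propositional using (_⊆_)
open import Data.List.Relation.Unary.Any using (here; there)
open import Data.Nat.Base using (ℕ; zero; suc; _+_; _⊔_; _≤_)
open import Data.Product.Base using (∃; ∃-syntax; Σ-syntax; _×_; _,_; proj₁; proj₂)
open import Data.Sum.Base using (_⊎_)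
open import Data.Unit.Base using (⊤)
open import Data.Vec.Functional using (Vector) renaming ([] to ∅; _∷_ to infixr 5 _▹_)
open import Function.Base using (_∘_)
open import Level using (Lift; 0ℓ) renaming (suc to lsuc)
open import Relation.Binary.Construct.Closure.ReflexiveTransitive using (Star)
open import Relation.Binary.PropositionalEquality.Core using (_≡_; refl)
open import Relation.Nullary.Negation.Core using (¬_)

------------------------------------------------------------------------
-- Formulas
--
-- Locally nameless syntax: free variables are names in ℕ, variables
-- bound by a quantifier are de Bruijn indices.  Bound variables have no
-- negated form, which is the condition that ¬x does not occur in the
-- body α of μλx.α or νλx.α.  Finite sets of formulas are lists.

data Literal : Set where
  pos neg : ℕ → Literal

data Quantifier : Set where
  μ ν : Quantifier

data Fml (n : ℕ) : Set where
  lit : Literal → Fml n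
  var : Fin n → Fml n
  ⋀ ⋁ : List (Fml n) → Fml n
  □ ◇ : Fml n → Fml n
  fix : Quantifier → Fml (suc n) → Fml n

Formula : Set
Formula = Fml 0

private
  variable
    m n : ℕ

lift-ren : (Fin m → Fin n) → Fin (suc m) → Fin (suc n)
lift-ren ρ zero    = zero
lift-ren ρ (suc i) = suc (ρ i)

ren  : (Fin m → Fin n) → Fml m → Fml n
rens : (Fin m → Fin n) → List (Fml m) → List (Fml n)
ren ρ (lit l)   = lit l
ren ρ (var i)   = var (ρ i)
ren ρ (⋀ Γ)     = ⋀ (rens ρ Γ)
ren ρ (⋁ Γ)     = ⋁ (rens ρ Γ)
ren ρ (□ α)     = □ (ren ρ α)
ren ρ (◇ α)     = ◇ (ren ρ α)
ren ρ (fix q α) = fix q (ren (lift-ren ρ) α)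
rens ρ []       = []
rens ρ (α ∷ Γ)  = ren ρ α ∷ rens ρ Γ

sub  : (Fin m → Fml n) → Fml m → Fml n
subs : (Fin m → Fml n) → List (Fml m) → List (Fml n)
sub σ (lit l)   = lit l
sub σ (var i)   = σ i
sub σ (⋀ Γ)     = ⋀ (subs σ Γ)
sub σ (⋁ Γ)     = ⋁ (subs σ Γ)
sub σ (□ α)     = □ (sub σ α)
sub σ (◇ α)     = ◇ (sub σ α)
sub σ (fix q α) = fix q (sub (var zero ▹ (ren suc ∘ σ)) α)
subs σ []       = []
subs σ (α ∷ Γ)  = sub σ α ∷ subs σ Γ

_⟨_⟩ : Fml (suc n) → Fml n → Fml n
φ ⟨ β ⟩ = sub (β ▹ var) φ

unfold : Quantifier → Fml (suc n) → Fml n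
unfold q φ = φ ⟨ fix q φ ⟩

dualˡ : Literal → Literal
dualˡ (pos x) = neg x
dualˡ (neg x) = pos x

dualᑫ : Quantifier → Quantifier
dualᑫ μ = ν
dualᑫ ν = μ

-- A bound variable is left alone: in (μλx.α)^⊥ = νλx.(α[x:=¬x])^⊥ it is
-- negated by the substitution and then once more by the dualisation.
dual  : Fml n → Fml n
duals : List (Fml n) → List (Fml n)
dual (lit l)   = lit (dualˡ l)
dual (var i)   = var i
dual (⋀ Γ)     = ⋁ (duals Γ)
dual (⋁ Γ)     = ⋀ (duals Γ)
dual (□ α)     = ◇ (dual α)
dual (◇ α)     = □ (dual α)
dual (fix q α) = fix (dualᑫ q) (dual α)
duals []       = []
duals (α ∷ Γ)  = dual α ∷ duals Γ

complexity  : Fml n → ℕ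
complexitys : List (Fml n) → ℕ
complexity (lit l)   = 0
complexity (var i)   = 0
complexity (⋀ Γ)     = suc (complexitys Γ)
complexity (⋁ Γ)     = suc (complexitys Γ)
complexity (□ α)     = suc (complexity α)
complexity (◇ α)     = suc (complexity α)
complexity (fix q α) = suc (complexity α)
complexitys []       = 0
complexitys (α ∷ Γ)  = complexity α ⊔ complexitys Γ

-- β ◁ α : β is an immediate subformula of α.
data _◁_ : Formula → Formula → Set where
  ⋀-sub   : ∀ {α Γ} → α ∈ Γ → α ◁ ⋀ Γ
  ⋁-sub   : ∀ {α Γ} → α ∈ Γ → α ◁ ⋁ Γ
  □-sub   : ∀ {α} → α ◁ □ α
  ◇-sub   : ∀ {α} → α ◁ ◇ α
  fix-sub : ∀ {q φ} → unfold q φ ◁ fix q φ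

Subformula : Formula → Formula → Set
Subformula = Star _◁_

------------------------------------------------------------------------
-- Disjunctive and conjunctive formulas

Consistent : List Literal → Set
Consistent L = ∀ x → ¬ (pos x ∈ L × neg x ∈ L)

-- The set of conjuncts of ∇_L(Γ,Δ).
cover : List Literal → List Formula → List Formula → List Formula
cover L Γ Δ = map lit L ++ map ◇ Γ ++ □ (⋁ Δ) ∷ []

IsCover : List Formula → Set
IsCover Θ = ∃[ L ] ∃[ Γ ] ∃[ Δ ] Consistent L × Γ ⊆ Δ × Θ ∼[ set ] cover L Γ Δ

Disjunctive : Formula → Set
Disjunctive α = ∀ Θ → Subformula (⋀ Θ) α → IsCover Θ

Conjunctive : Formula → Set
Conjunctive α = Disjunctive (dual α)

------------------------------------------------------------------------
-- Semantics

record Model : Set₁ where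
  field
    World       : Set
    _⟶_         : World → World → Set
    Val         : ℕ → World → Set
    root        : World
    reachable   : ∀ w → Star _⟶_ root w
    root-source : ∀ w → ¬ (w ⟶ root)
    parent-uniq : ∀ {u v w} → u ⟶ w → v ⟶ w → u ≡ v

-- Classical truth, expressed by double negation: disjunctions,
-- existentials and atoms, including membership in a set of worlds, carry
-- ¬ ¬.  Under excluded middle the ¬ ¬ can be erased and every predicate
-- on worlds is equivalent to a small one, so μ and ν denote the
-- intersection of all prefixed and the union of all postfixed sets of
-- worlds, i.e. the least and greatest fixed points.
module Semantics (M : Model) where
  open Model M

  ⟦_⟧  : Fml n → Vector (World → Set) n → World → Set₁
  ⟦_⟧⋀ : List (Fml n) → Vector (World → Set) n → World → Set₁
  ⟦_⟧⋁ : List (Fml n) → Vector (World → Set) n → World → Set₁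
  ⟦ lit (pos x) ⟧ ρ w = Lift (lsuc 0ℓ) (¬ ¬ Val x w)
  ⟦ lit (neg x) ⟧ ρ w = Lift (lsuc 0ℓ) (¬ Val x w)
  ⟦ var i ⟧       ρ w = Lift (lsuc 0ℓ) (¬ ¬ ρ i w)
  ⟦ ⋀ Γ ⟧         ρ w = ⟦ Γ ⟧⋀ ρ w
  ⟦ ⋁ Γ ⟧         ρ w = ¬ ¬ ⟦ Γ ⟧⋁ ρ w
  ⟦ □ α ⟧         ρ w = ∀ v → w ⟶ v → ⟦ α ⟧ ρ v
  ⟦ ◇ α ⟧         ρ w = ¬ ¬ (∃[ v ] w ⟶ v × ⟦ α ⟧ ρ v)
  ⟦ fix μ α ⟧     ρ w =
    ∀ (X : World → Set) → (∀ v → ⟦ α ⟧ (X ▹ ρ) v → ¬ ¬ X v) → ¬ ¬ X w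
  ⟦ fix ν α ⟧     ρ w =
    ¬ ¬ (Σ[ X ∈ (World → Set) ] (∀ v → X v → ⟦ α ⟧ (X ▹ ρ) v) × X w)
  ⟦ [] ⟧⋀    ρ w = Lift (lsuc 0ℓ) ⊤
  ⟦ α ∷ Γ ⟧⋀ ρ w = ⟦ α ⟧ ρ w × ⟦ Γ ⟧⋀ ρ w
  ⟦ [] ⟧⋁    ρ w = Lift (lsuc 0ℓ) ⊥
  ⟦ α ∷ Γ ⟧⋁ ρ w = ⟦ α ⟧ ρ w ⊎ ⟦ Γ ⟧⋁ ρ w

Valid : Formula → Set₁
Valid α = ∀ M → Semantics.⟦_⟧ M α ∅ (Model.root M)

------------------------------------------------------------------------
-- The calculus

infix 4 _⇒_

record Sequent : Set where
  constructor _⇒_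
  field
    left right : List Formula

open Sequent public

data Side : Set where
  left-side right-side : Side

on : Side → Sequent → List Formula
on left-side  = left
on right-side = right

-- The index is the conclusion.  The principal formula is put first on
-- its side, which the exchange rule makes immaterial.
data Rule : Sequent → Set where
  ax-⊥     : ∀ x → Rule (lit (pos x) ∷ lit (neg x) ∷ [] ⇒ [])
  ax-⊤     : ∀ x → Rule ([] ⇒ lit (neg x) ∷ lit (pos x) ∷ [])
  ax-id    : ∀ x → Rule (lit (pos x) ∷ [] ⇒ lit (pos x) ∷ [])
  exchange : ∀ {Φ Φ′ Ψ Ψ′} → Φ ↭ Φ′ → Ψ ↭ Ψ′ → Rule (Φ ⇒ Ψ)
  contrL   : ∀ α Φ Ψ → Rule (α ∷ Φ ⇒ Ψ)
  contrR   : ∀ α Φ Ψ → Rule (Φ ⇒ α ∷ Ψ)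
  weakL    : ∀ α Φ Ψ → Rule (α ∷ Φ ⇒ Ψ)
  weakR    : ∀ α Φ Ψ → Rule (Φ ⇒ α ∷ Ψ)
  ⋀L       : ∀ {α Γ} → α ∈ Γ → ∀ Φ Ψ → Rule (⋀ Γ ∷ Φ ⇒ Ψ)
  ⋁L       : ∀ Γ Φ Ψ → Rule (⋁ Γ ∷ Φ ⇒ Ψ)
  fixL     : ∀ q φ Φ Ψ → Rule (fix q φ ∷ Φ ⇒ Ψ)
  ◇L       : ∀ α Φ Ψ → Rule (◇ α ∷ map □ Φ ⇒ map ◇ Ψ)
  ⋀R       : ∀ Γ Φ Ψ → Rule (Φ ⇒ ⋀ Γ ∷ Ψ)
  ⋁R       : ∀ {α Γ} → α ∈ Γ → ∀ Φ Ψ → Rule (Φ ⇒ ⋁ Γ ∷ Ψ)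
  fixR     : ∀ q φ Φ Ψ → Rule (Φ ⇒ fix q φ ∷ Ψ)
  □R       : ∀ α Φ Ψ → Rule (map □ Φ ⇒ □ α ∷ map ◇ Ψ)

private
  variable
    S : Sequent

Premise : Rule S → Set
Premise (ax-⊥ x)       = ⊥
Premise (ax-⊤ x)       = ⊥
Premise (ax-id x)      = ⊥
Premise (exchange π ρ) = ⊤
Premise (contrL α Φ Ψ) = ⊤
Premise (contrR α Φ Ψ) = ⊤
Premise (weakL α Φ Ψ)  = ⊤
Premise (weakR α Φ Ψ)  = ⊤
Premise (⋀L α∈Γ Φ Ψ)   = ⊤
Premise (⋁L Γ Φ Ψ)     = ∃[ α ] α ∈ Γ
Premise (fixL q φ Φ Ψ) = ⊤
Premise (◇L α Φ Ψ)     = ⊤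
Premise (⋀R Γ Φ Ψ)     = ∃[ α ] α ∈ Γ
Premise (⋁R α∈Γ Φ Ψ)   = ⊤
Premise (fixR q φ Φ Ψ) = ⊤
Premise (□R α Φ Ψ)     = ⊤

premise : (r : Rule S) → Premise r → Sequent
premise (exchange {Φ′ = Φ′} {Ψ′ = Ψ′} π ρ) _ = Φ′ ⇒ Ψ′
premise (contrL α Φ Ψ)       _       = α ∷ α ∷ Φ ⇒ Ψ
premise (contrR α Φ Ψ)       _       = Φ ⇒ α ∷ α ∷ Ψ
premise (weakL α Φ Ψ)        _       = Φ ⇒ Ψ
premise (weakR α Φ Ψ)        _       = Φ ⇒ Ψ
premise (⋀L {α} α∈Γ Φ Ψ)     _       = α ∷ Φ ⇒ Ψ
premise (⋁L Γ Φ Ψ)           (α , _) = α ∷ Φ ⇒ Ψ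
premise (fixL q φ Φ Ψ)       _       = unfold q φ ∷ Φ ⇒ Ψ
premise (◇L α Φ Ψ)           _       = α ∷ Φ ⇒ Ψ
premise (⋀R Γ Φ Ψ)           (α , _) = Φ ⇒ α ∷ Ψ
premise (⋁R {α} α∈Γ Φ Ψ)     _       = Φ ⇒ α ∷ Ψ
premise (fixR q φ Φ Ψ)       _       = Φ ⇒ unfold q φ ∷ Ψ
premise (□R α Φ Ψ)           _       = Φ ⇒ α ∷ Ψ

Logical : Rule S → Set
Logical (ax-⊥ x)       = ⊥
Logical (ax-⊤ x)       = ⊥
Logical (ax-id x)      = ⊥
Logical (exchange π ρ) = ⊥
Logical (contrL α Φ Ψ) = ⊥
Logical (contrR α Φ Ψ) = ⊥
Logical (weakL α Φ Ψ)  = ⊥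
Logical (weakR α Φ Ψ)  = ⊥
Logical (⋀L α∈Γ Φ Ψ)   = ⊤
Logical (⋁L Γ Φ Ψ)     = ⊤
Logical (fixL q φ Φ Ψ) = ⊤
Logical (◇L α Φ Ψ)     = ⊤
Logical (⋀R Γ Φ Ψ)     = ⊤
Logical (⋁R α∈Γ Φ Ψ)   = ⊤
Logical (fixR q φ Φ Ψ) = ⊤
Logical (□R α Φ Ψ)     = ⊤

------------------------------------------------------------------------
-- How occurrences in a conclusion are continued in a premise

Occ : List Formula → Set
Occ Φ = ∃[ α ] α ∈ Φ

-- advance : from the principal formula of a logical rule to its minor
-- formula, an immediate subformula.  stay : the formula is unchanged.
-- The two cannot be told apart by the formulas: νλx.x unfolds to itself.
data Kind : Set where
  stay advance : Kind

Link : List Formula → List Formula → Set₁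
Link Φ Φ′ = Kind → Occ Φ → Occ Φ′ → Set

data Same {Φ} : Link Φ Φ where
  same : ∀ o → Same stay o o

data Permuted {Φ Φ′} (π : Φ ↭ Φ′) : Link Φ Φ′ where
  permuted : ∀ {β} (p : β ∈ Φ) → Permuted π stay (β , p) (β , ∈-resp-↭ π p)

data Contracted {α Φ} : Link (α ∷ Φ) (α ∷ α ∷ Φ) where
  first  : Contracted stay (α , here refl) (α , here refl)
  second : Contracted stay (α , here refl) (α , there (here refl))
  side   : ∀ {β} (p : β ∈ Φ) → Contracted stay (β , there p) (β , there (there p))

data Weakened {α Φ} : Link (α ∷ Φ) Φ where
  side : ∀ {β} (p : β ∈ Φ) → Weakened stay (β , there p) (β , p)

data Replaced {α β Φ} : Link (α ∷ Φ) (β ∷ Φ) where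
  principal : Replaced advance (α , here refl) (β , here refl)
  side      : ∀ {γ} (p : γ ∈ Φ) → Replaced stay (γ , there p) (γ , there p)

-- In the modal rules every formula of the conclusion is principal.
data Stripped (f : Formula → Formula) {Φ} : Link (map f Φ) Φ where
  strip : ∀ {β} (p : β ∈ Φ) → Stripped f advance (f β , ∈-map⁺ f p) (β , p)

data Stripped⁺ (f g : Formula → Formula) {α Φ} : Link (f α ∷ map g Φ) (α ∷ Φ) where
  strip-head : Stripped⁺ f g advance (f α , here refl) (α , here refl)
  strip-tail : ∀ {β} (p : β ∈ Φ) →
               Stripped⁺ f g advance (g β , there (∈-map⁺ g p)) (β , there p)

link : (s : Side) (r : Rule S) (i : Premise r) → Link (on s S) (on s (premise r i))
link left-side  (exchange π ρ) _ = Permuted π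
link right-side (exchange π ρ) _ = Permuted ρ
link left-side  (contrL α Φ Ψ) _ = Contracted
link right-side (contrL α Φ Ψ) _ = Same
link left-side  (contrR α Φ Ψ) _ = Same
link right-side (contrR α Φ Ψ) _ = Contracted
link left-side  (weakL α Φ Ψ)  _ = Weakened
link right-side (weakL α Φ Ψ)  _ = Same
link left-side  (weakR α Φ Ψ)  _ = Same
link right-side (weakR α Φ Ψ)  _ = Weakened
link left-side  (⋀L α∈Γ Φ Ψ)   _ = Replaced
link right-side (⋀L α∈Γ Φ Ψ)   _ = Same
link left-side  (⋁L Γ Φ Ψ)     _ = Replaced
link right-side (⋁L Γ Φ Ψ)     _ = Same
link left-side  (fixL q φ Φ Ψ) _ = Replaced
link right-side (fixL q φ Φ Ψ) _ = Same
link left-side  (◇L α Φ Ψ)     _ = Stripped⁺ ◇ □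
link right-side (◇L α Φ Ψ)     _ = Stripped ◇
link left-side  (⋀R Γ Φ Ψ)     _ = Same
link right-side (⋀R Γ Φ Ψ)     _ = Replaced
link left-side  (⋁R α∈Γ Φ Ψ)   _ = Same
link right-side (⋁R α∈Γ Φ Ψ)   _ = Replaced
link left-side  (fixR q φ Φ Ψ) _ = Same
link right-side (fixR q φ Φ Ψ) _ = Replaced
link left-side  (□R α Φ Ψ)     _ = Stripped □
link right-side (□R α Φ Ψ)     _ = Stripped⁺ □ ◇

------------------------------------------------------------------------
-- Derivations, branches, traces and threads

-- A possibly infinite derivation, given as a coalgebra: the derivation
-- tree is the unravelling from the root.  Node S is the type of nodes
-- labelled by S.  Leaves carry rules without premises: axioms, ⋁L and
-- ⋀R for the empty set.
record Derivation (S₀ : Sequent) : Set₁ where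
  field
    Node : Sequent → Set
    root : Node S₀
    rule : ∀ {S} → Node S → Rule S
    next : ∀ {S} (n : Node S) (i : Premise (rule n)) → Node (premise (rule n) i)

  data _↝_ : ∃ Node → ∃ Node → Set where
    step : ∀ {S} (n : Node S) (i : Premise (rule n)) →
           (S , n) ↝ (premise (rule n) i , next n i)

  link↝ : ∀ {x y} (s : Side) → x ↝ y → Link (on s (proj₁ x)) (on s (proj₁ y))
  link↝ s (step n i) = link s (rule n) i

  record Branch : Set where
    field
      node  : ℕ → ∃ Node
      start : node 0 ≡ (S₀ , root)
      steps : ∀ i → node i ↝ node (suc i)

-- ¬ ¬ makes this the classical notion.
InfinitelyOften : (ℕ → Set) → Set
InfinitelyOften P = ∀ k → ¬ ¬ (∃[ i ] k ≤ i × P i)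

record Thread : Set where
  field
    formula  : ℕ → Formula
    descends : ∀ i → formula (suc i) ◁ formula i

IsThread : Quantifier → Thread → Set
IsThread q θ = ∃[ φ ] Recurs (fix q φ) × (∀ β → Recurs β → complexity (fix q φ) ≤ complexity β)
  where
  Recurs : Formula → Set
  Recurs α = InfinitelyOften (λ i → Thread.formula θ i ≡ α)

module _ {S₀ : Sequent} {d : Derivation S₀} where
  open Derivation d

  record Trace (s : Side) (b : Branch) : Set where
    open Branch b
    field
      occ    : ∀ i → Occ (on s (proj₁ (node i)))
      kind   : ℕ → Kind
      linked : ∀ i → link↝ s (steps i) (kind i) (occ i) (occ (suc i))

  advances : Kind → ℕ
  advances stay    = 0
  advances advance = 1

  position : ∀ {s b} → Trace s b → ℕ → ℕ
  position t zero    = 0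
  position t (suc i) = advances (Trace.kind t i) + position t i

  -- The trace runs through the whole infinite thread; in particular a
  -- trace that is eventually a side formula forever supports none.
  Supports : ∀ {s b} → Trace s b → Thread → Set
  Supports t θ =
    (∀ i → proj₁ (Trace.occ t i) ≡ Thread.formula θ (position t i)) ×
    (∀ k → ∃[ i ] k ≤ position t i)

  Carries : Side → Quantifier → Branch → Set
  Carries s q b = Σ[ t ∈ Trace s b ] ∃[ θ ] Supports t θ × IsThread q θ

IsCoProof : ∀ {S₀} → Derivation S₀ → Set
IsCoProof d = ∀ (b : Branch) →
  InfinitelyOften (λ i → Logical (rule (proj₂ (Branch.node b i)))) ×
  ¬ ¬ (Carries {d = d} left-side μ b ⊎ Carries {d = d} right-side ν b)
  where open Derivation d

Constructive : ∀ {S₀} → Derivation S₀ → Set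
Constructive {S₀} d =
  ∀ {S} (n : Node S) → Star _↝_ (S₀ , root) (S , n) → length (right S) ≤ 1
  where open Derivation d

_⊩_ : List Formula → Formula → Set₁
Φ ⊩ α = Σ[ d ∈ Derivation (Φ ⇒ α ∷ []) ] IsCoProof d × Constructive d

{-# OPTIONS --safe #-}

-- Reading □ as transparent and literals and ◇ as false, the value of a formula
-- is decided by recursion: a monotone Boolean function reaches its least and
-- greatest fixed points after one iteration, so ν-bound variables count as true
-- and μ-bound ones as false.  If the value is true, following true subformulas
-- gives a co-proof of ⇒ α: the only bound variables ever met are ν-bound, so on
-- each branch the outermost quantifier unfolded infinitely often is a ν.  If the
-- value is false and α is conjunctive, the choices of false subformulas span a
-- tree model refuting α: each disjunction is the dual of a cover, so its □-disjuncts
-- can be refuted independently in distinct children, each of which also refutes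
-- its ◇-disjunct.

module Submission where

open import Data.Empty using (⊥; ⊥-elim)
open import Data.Fin.Base using (Fin; zero; suc)
open import Data.List.Base using (List; []; _∷_; map; filter; length)
open import Data.List.Membership.Propositional using (_∈_; _∉_)
open import Data.List.Membership.Propositional.Properties
  using (∈-map⁺; ∈-map⁻; ∈-++⁻; ∈-filter⁺; ∈-filter⁻)
open import Data.List.Relation.Unary.All using (All; []; _∷_)
open import Data.List.Relation.Unary.Any using (Any; here; there)
open import Data.Nat.Base using (ℕ; zero; suc; _⊔_; _≤_; _<_; z≤n; s≤s)
open import Data.Nat.Properties
  using (≤-refl; ≤-reflexive; ≤-trans; ≤-antisym; <-trans; <-irrefl; ≤-<-trans; <⇒≤; ≮⇒≥;
         m≤n⇒m≤1+n; m≤m⊔n; m≤n⊔m; _≤?_; _<?_)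
open import Data.Product.Base using (∃-syntax; Σ-syntax; _×_; _,_; proj₁; proj₂)
open import Data.Sum.Base using (_⊎_; inj₁; inj₂)
open import Data.Unit.Base using (tt)
open import Data.Vec.Base using (Vec; []; _∷_; lookup)
open import Data.Vec.Functional using (Vector) renaming ([] to ∅; _∷_ to infixr 5 _▹_)
open import Function.Base using (_∘_)
open import Function.Bundles using (Equivalence)
open import Level using (lift)
open import Relation.Binary.Construct.Closure.ReflexiveTransitive using (Star; ε; _◅_; _◅◅_)
open import Relation.Binary.PropositionalEquality
  using (_≡_; _≢_; refl; sym; trans; cong; cong₂; subst)
open import Relation.Nullary.Decidable.Core
  using (yes; no; ¬¬-excluded-middle; decidable-stable)
open import Relation.Nullary.Negation.Core using (¬_; contradiction)

open import Defs

private
  variable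
    k m n : ℕ

-- Renaming and substitution

lift-sub : (Fin m → Fml n) → Fin (suc m) → Fml (suc n)
lift-sub σ = var zero ▹ (ren suc ∘ σ)

-- The composite enters as a third map that agrees pointwise. Here and in the fusion lemmas below,
-- this form of the hypothesis passes directly under a binder.
ren-ren : {f : Fin m → Fin n} {g : Fin k → Fin m} {h : Fin k → Fin n} →
          (∀ i → f (g i) ≡ h i) → ∀ β → ren f (ren g β) ≡ ren h β
rens-rens : {f : Fin m → Fin n} {g : Fin k → Fin m} {h : Fin k → Fin n} →
            (∀ i → f (g i) ≡ h i) → ∀ Γ → rens f (rens g Γ) ≡ rens h Γ
ren-ren eq (lit l)   = refl
ren-ren eq (var i)   = cong var (eq i)
ren-ren eq (⋀ Γ)     = cong ⋀ (rens-rens eq Γ)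
ren-ren eq (⋁ Γ)     = cong ⋁ (rens-rens eq Γ)
ren-ren eq (□ β)     = cong □ (ren-ren eq β)
ren-ren eq (◇ β)     = cong ◇ (ren-ren eq β)
ren-ren eq (fix q β) = cong (fix q) (ren-ren (λ { zero → refl ; (suc i) → cong suc (eq i) }) β)
rens-rens eq []      = refl
rens-rens eq (β ∷ Γ) = cong₂ _∷_ (ren-ren eq β) (rens-rens eq Γ)

sub-ren : {σ : Fin m → Fml n} {f : Fin k → Fin m} {τ : Fin k → Fml n} →
          (∀ i → σ (f i) ≡ τ i) → ∀ β → sub σ (ren f β) ≡ sub τ β
subs-rens : {σ : Fin m → Fml n} {f : Fin k → Fin m} {τ : Fin k → Fml n} →
            (∀ i → σ (f i) ≡ τ i) → ∀ Γ → subs σ (rens f Γ) ≡ subs τ Γ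
sub-ren eq (lit l)   = refl
sub-ren eq (var i)   = eq i
sub-ren eq (⋀ Γ)     = cong ⋀ (subs-rens eq Γ)
sub-ren eq (⋁ Γ)     = cong ⋁ (subs-rens eq Γ)
sub-ren eq (□ β)     = cong □ (sub-ren eq β)
sub-ren eq (◇ β)     = cong ◇ (sub-ren eq β)
sub-ren eq (fix q β) =
  cong (fix q) (sub-ren (λ { zero → refl ; (suc i) → cong (ren suc) (eq i) }) β)
subs-rens eq []      = refl
subs-rens eq (β ∷ Γ) = cong₂ _∷_ (sub-ren eq β) (subs-rens eq Γ)

ren-suc-lift : (f : Fin m → Fin n) (β : Fml m) →
               ren (lift-ren f) (ren suc β) ≡ ren suc (ren f β)
ren-suc-lift f β = trans (ren-ren (λ _ → refl) β) (sym (ren-ren (λ _ → refl) β))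

ren-sub : {f : Fin m → Fin n} {σ : Fin k → Fml m} {τ : Fin k → Fml n} →
          (∀ i → ren f (σ i) ≡ τ i) → ∀ β → ren f (sub σ β) ≡ sub τ β
rens-subs : {f : Fin m → Fin n} {σ : Fin k → Fml m} {τ : Fin k → Fml n} →
            (∀ i → ren f (σ i) ≡ τ i) → ∀ Γ → rens f (subs σ Γ) ≡ subs τ Γ
ren-sub eq (lit l)   = refl
ren-sub eq (var i)   = eq i
ren-sub eq (⋀ Γ)     = cong ⋀ (rens-subs eq Γ)
ren-sub eq (⋁ Γ)     = cong ⋁ (rens-subs eq Γ)
ren-sub eq (□ β)     = cong □ (ren-sub eq β)
ren-sub eq (◇ β)     = cong ◇ (ren-sub eq β)
ren-sub {f = f} {σ} eq (fix q β) = cong (fix q) (ren-sub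
  (λ { zero → refl ; (suc i) → trans (ren-suc-lift f (σ i)) (cong (ren suc) (eq i)) }) β)
rens-subs eq []      = refl
rens-subs eq (β ∷ Γ) = cong₂ _∷_ (ren-sub eq β) (rens-subs eq Γ)

sub-suc-lift : (σ : Fin m → Fml n) (β : Fml m) →
               sub (lift-sub σ) (ren suc β) ≡ ren suc (sub σ β)
sub-suc-lift σ β = trans (sub-ren (λ _ → refl) β) (sym (ren-sub (λ _ → refl) β))

sub-sub : {σ : Fin m → Fml n} {τ : Fin k → Fml m} {υ : Fin k → Fml n} →
          (∀ i → sub σ (τ i) ≡ υ i) → ∀ β → sub σ (sub τ β) ≡ sub υ β
subs-subs : {σ : Fin m → Fml n} {τ : Fin k → Fml m} {υ : Fin k → Fml n} →
            (∀ i → sub σ (τ i) ≡ υ i) → ∀ Γ → subs σ (subs τ Γ) ≡ subs υ Γ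
sub-sub eq (lit l)   = refl
sub-sub eq (var i)   = eq i
sub-sub eq (⋀ Γ)     = cong ⋀ (subs-subs eq Γ)
sub-sub eq (⋁ Γ)     = cong ⋁ (subs-subs eq Γ)
sub-sub eq (□ β)     = cong □ (sub-sub eq β)
sub-sub eq (◇ β)     = cong ◇ (sub-sub eq β)
sub-sub {σ = σ} {τ} eq (fix q β) = cong (fix q) (sub-sub
  (λ { zero → refl ; (suc i) → trans (sub-suc-lift σ (τ i)) (cong (ren suc) (eq i)) }) β)
subs-subs eq []      = refl
subs-subs eq (β ∷ Γ) = cong₂ _∷_ (sub-sub eq β) (subs-subs eq Γ)

sub-id : {σ : Fin n → Fml n} → (∀ i → σ i ≡ var i) → ∀ β → sub σ β ≡ β
subs-id : {σ : Fin n → Fml n} → (∀ i → σ i ≡ var i) → ∀ Γ → subs σ Γ ≡ Γ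
sub-id eq (lit l)   = refl
sub-id eq (var i)   = eq i
sub-id eq (⋀ Γ)     = cong ⋀ (subs-id eq Γ)
sub-id eq (⋁ Γ)     = cong ⋁ (subs-id eq Γ)
sub-id eq (□ β)     = cong □ (sub-id eq β)
sub-id eq (◇ β)     = cong ◇ (sub-id eq β)
sub-id eq (fix q β) = cong (fix q) (sub-id (λ { zero → refl ; (suc i) → cong (ren suc) (eq i) }) β)
subs-id eq []      = refl
subs-id eq (β ∷ Γ) = cong₂ _∷_ (sub-id eq β) (subs-id eq Γ)

-- Instantiation cancels the weakening that `lift-sub` put on the images of the other variables.
-- Unfolding a closed instance thus amounts to reading the same open body under an extended
-- substitution, so both halves of the proof can recurse on open bodies.
unfold-sub : ∀ q (φ : Fml (suc n)) (σ : Fin n → Fml m) →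
             unfold q (sub (lift-sub σ) φ) ≡ sub (sub σ (fix q φ) ▹ σ) φ
unfold-sub q φ σ = sub-sub
  (λ { zero → refl ; (suc i) → trans (sub-ren (λ _ → refl) (σ i)) (sub-id (λ _ → refl) (σ i)) }) φ

subs-map : (σ : Fin m → Fml n) (Γ : List (Fml m)) → subs σ Γ ≡ map (sub σ) Γ
subs-map σ []      = refl
subs-map σ (β ∷ Γ) = cong (sub σ β ∷_) (subs-map σ Γ)

∈-subs⁺ : (σ : Fin m → Fml n) {β : Fml m} {Γ : List (Fml m)} → β ∈ Γ → sub σ β ∈ subs σ Γ
∈-subs⁺ σ {Γ = Γ} β∈Γ = subst (_ ∈_) (sym (subs-map σ Γ)) (∈-map⁺ (sub σ) β∈Γ)

∈-subs⁻ : (σ : Fin m → Fml n) {α : Fml n} (Γ : List (Fml m)) →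
          α ∈ subs σ Γ → ∃[ β ] β ∈ Γ × α ≡ sub σ β
∈-subs⁻ σ Γ α∈ = ∈-map⁻ (sub σ) (subst (_ ∈_) (subs-map σ Γ) α∈)

-- Free variables and complexity

data Free {n} (i : Fin n) : Fml n → Set where
  var : Free i (var i)
  ⋀   : ∀ {β Γ} → β ∈ Γ → Free i β → Free i (⋀ Γ)
  ⋁   : ∀ {β Γ} → β ∈ Γ → Free i β → Free i (⋁ Γ)
  □   : ∀ {β} → Free i β → Free i (□ β)
  ◇   : ∀ {β} → Free i β → Free i (◇ β)
  fix : ∀ {q φ} → Free (suc i) φ → Free i (fix q φ)

complexity-ren : (f : Fin m → Fin n) (β : Fml m) → complexity (ren f β) ≡ complexity β
complexity-rens : (f : Fin m → Fin n) (Γ : List (Fml m)) → complexitys (rens f Γ) ≡ complexitys Γ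
complexity-ren f (lit l)   = refl
complexity-ren f (var i)   = refl
complexity-ren f (⋀ Γ)     = cong suc (complexity-rens f Γ)
complexity-ren f (⋁ Γ)     = cong suc (complexity-rens f Γ)
complexity-ren f (□ β)     = cong suc (complexity-ren f β)
complexity-ren f (◇ β)     = cong suc (complexity-ren f β)
complexity-ren f (fix q β) = cong suc (complexity-ren (lift-ren f) β)
complexity-rens f []       = refl
complexity-rens f (β ∷ Γ)  = cong₂ _⊔_ (complexity-ren f β) (complexity-rens f Γ)

complexity-∈ : {β : Fml n} {Γ : List (Fml n)} → β ∈ Γ → complexity β ≤ complexitys Γ
complexity-∈ {Γ = β ∷ Γ} (here refl) = m≤m⊔n (complexity β) (complexitys Γ)
complexity-∈ {Γ = β ∷ Γ} (there p)   =
  ≤-trans (complexity-∈ p) (m≤n⊔m (complexity β) (complexitys Γ))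

complexity-∈-subs : (σ : Fin m → Fml n) {β : Fml m} {Γ : List (Fml m)} → β ∈ Γ →
                    complexity (sub σ β) ≤ suc (complexitys (subs σ Γ))
complexity-∈-subs σ β∈Γ = m≤n⇒m≤1+n (complexity-∈ (∈-subs⁺ σ β∈Γ))

free-≤ : (σ : Fin m → Fml n) {i : Fin m} {β : Fml m} → Free i β →
         complexity (σ i) ≤ complexity (sub σ β)
free-≤ σ var         = ≤-refl
free-≤ σ (⋀ β∈Γ fr) = ≤-trans (free-≤ σ fr) (complexity-∈-subs σ β∈Γ)
free-≤ σ (⋁ β∈Γ fr) = ≤-trans (free-≤ σ fr) (complexity-∈-subs σ β∈Γ)
free-≤ σ (□ fr)      = m≤n⇒m≤1+n (free-≤ σ fr)
free-≤ σ (◇ fr)      = m≤n⇒m≤1+n (free-≤ σ fr)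
free-≤ σ (fix {φ = φ} fr) = m≤n⇒m≤1+n
  (subst (_≤ complexity (sub (lift-sub σ) φ)) (complexity-ren suc _) (free-≤ (lift-sub σ) fr))

-- The quantifier itself accounts for the strictness. Hence an enclosing fixpoint is less complex
-- than any fixpoint that depends on it, which orders the loops both in the co-proof and in the
-- countermodel.
free-fix-< : (σ : Fin m → Fml n) {i : Fin m} {q : Quantifier} {φ : Fml (suc m)} →
             Free i (fix q φ) → complexity (σ i) < complexity (sub σ (fix q φ))
free-fix-< σ {φ = φ} (fix fr) = s≤s
  (subst (_≤ complexity (sub (lift-sub σ) φ)) (complexity-ren suc _) (free-≤ (lift-sub σ) fr))

-- Evaluating a formula

data Provable (Q : Vec Quantifier n) : Fml n → Set where
  var : ∀ {i} → lookup Q i ≡ ν → Provable Q (var i)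
  ⋀   : ∀ {Γ} → All (Provable Q) Γ → Provable Q (⋀ Γ)
  ⋁   : ∀ {Γ} → Any (Provable Q) Γ → Provable Q (⋁ Γ)
  □   : ∀ {β} → Provable Q β → Provable Q (□ β)
  fix : ∀ {q φ} → Provable (q ∷ Q) φ → Provable Q (fix q φ)

data Refutable (Q : Vec Quantifier n) : Fml n → Set where
  var : ∀ {i} → lookup Q i ≡ μ → Refutable Q (var i)
  lit : ∀ {l} → Refutable Q (lit l)
  ⋀   : ∀ {Γ} → Any (Refutable Q) Γ → Refutable Q (⋀ Γ)
  ⋁   : ∀ {Γ} → All (Refutable Q) Γ → Refutable Q (⋁ Γ)
  □   : ∀ {β} → Refutable Q β → Refutable Q (□ β)
  ◇   : ∀ {β} → Refutable Q (◇ β)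
  fix : ∀ {q φ} → Refutable (q ∷ Q) φ → Refutable Q (fix q φ)

evaluate : (Q : Vec Quantifier n) (β : Fml n) → Provable Q β ⊎ Refutable Q β
evaluate-all : (Q : Vec Quantifier n) (Γ : List (Fml n)) → All (Provable Q) Γ ⊎ Any (Refutable Q) Γ
evaluate-any : (Q : Vec Quantifier n) (Γ : List (Fml n)) → Any (Provable Q) Γ ⊎ All (Refutable Q) Γ
evaluate Q (lit l) = inj₂ lit
evaluate Q (var i) with lookup Q i in eq
... | μ = inj₂ (var eq)
... | ν = inj₁ (var eq)
evaluate Q (⋀ Γ) with evaluate-all Q Γ
... | inj₁ p = inj₁ (⋀ p)
... | inj₂ r = inj₂ (⋀ r)
evaluate Q (⋁ Γ) with evaluate-any Q Γ
... | inj₁ p = inj₁ (⋁ p)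
... | inj₂ r = inj₂ (⋁ r)
evaluate Q (□ β) with evaluate Q β
... | inj₁ p = inj₁ (□ p)
... | inj₂ r = inj₂ (□ r)
evaluate Q (◇ β) = inj₂ ◇
evaluate Q (fix q φ) with evaluate (q ∷ Q) φ
... | inj₁ p = inj₁ (fix p)
... | inj₂ r = inj₂ (fix r)
evaluate-all Q [] = inj₁ []
evaluate-all Q (β ∷ Γ) with evaluate Q β | evaluate-all Q Γ
... | inj₂ r | _       = inj₂ (here r)
... | inj₁ p | inj₁ ps = inj₁ (p ∷ ps)
... | inj₁ p | inj₂ r  = inj₂ (there r)
evaluate-any Q [] = inj₂ []
evaluate-any Q (β ∷ Γ) with evaluate Q β | evaluate-any Q Γ
... | inj₁ p | _       = inj₁ (here p)
... | inj₂ r | inj₁ p  = inj₁ (there p)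
... | inj₂ r | inj₂ rs = inj₂ (r ∷ rs)

-- The co-proof of a provable formula

-- The quantifiers in whose scope a subformula stands, innermost first, each
-- with its body and the evidence for that body to which a loop returns.
data Scope : Vec Quantifier n → Set where
  []   : Scope []
  bind : ∀ {Q : Vec Quantifier n} → Scope Q → ∀ q φ → Provable (q ∷ Q) φ → Scope (q ∷ Q)

closure : {Q : Vec Quantifier n} → Scope Q → Fin n → Formula
closure (bind e q φ p) = sub (closure e) (fix q φ) ▹ closure e

goal : Formula → Sequent
goal α = [] ⇒ α ∷ []

-- Variables have no nodes of their own: `enter` sends them to the node of their binder, so every
-- node applies a logical rule.
data Node : Sequent → Set where
  ⋀-node : ∀ {Q : Vec Quantifier n} {Γ} (e : Scope Q) → All (Provable Q) Γ →
           Node (goal (sub (closure e) (⋀ Γ)))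
  ⋁-node : ∀ {Q : Vec Quantifier n} {Γ} (e : Scope Q) → Any (Provable Q) Γ →
           Node (goal (sub (closure e) (⋁ Γ)))
  □-node : ∀ {Q : Vec Quantifier n} {β} (e : Scope Q) → Provable Q β →
           Node (goal (sub (closure e) (□ β)))
  fix-node : ∀ {Q : Vec Quantifier n} {q φ} (e : Scope Q) → Provable (q ∷ Q) φ →
             Node (goal (sub (closure e) (fix q φ)))

-- The stored evidence makes a return arrive at the very node that was unfolded before; the branch
-- analysis recognises returns by this equality.
loop : {Q : Vec Quantifier n} (e : Scope Q) (i : Fin n) → Node (goal (closure e i))
loop (bind e q φ p) zero    = fix-node e p
loop (bind e q φ p) (suc i) = loop e i

enter : ∀ {Q : Vec Quantifier n} {β α} (e : Scope Q) → Provable Q β → α ≡ sub (closure e) β →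
        Node (goal α)
enter e (var {i} _) refl = loop e i
enter e (⋀ ps)      refl = ⋀-node e ps
enter e (⋁ p)       refl = ⋁-node e p
enter e (□ p)       refl = □-node e p
enter e (fix p)     refl = fix-node e p

enter-∈ : ∀ {Q : Vec Quantifier n} {Γ α} (e : Scope Q) → All (Provable Q) Γ →
          α ∈ subs (closure e) Γ → Node (goal α)
enter-∈ e (p ∷ ps) (here eq)  = enter e p eq
enter-∈ e (p ∷ ps) (there α∈) = enter-∈ e ps α∈

witness : ∀ {Q : Vec Quantifier n} {Γ} (e : Scope Q) → Any (Provable Q) Γ →
          Σ[ β ∈ Fml n ] Provable Q β × β ∈ Γ × sub (closure e) β ∈ subs (closure e) Γ
witness e (here p)  = _ , p , here refl , here refl
witness e (there p) =
  let β , pβ , β∈Γ , α∈ = witness e p in β , pβ , there β∈Γ , there α∈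

node-rule : ∀ {S} → Node S → Rule S
node-rule (⋀-node {Γ = Γ} e ps) = ⋀R (subs (closure e) Γ) [] []
node-rule (⋁-node e p)          = ⋁R (proj₂ (proj₂ (proj₂ (witness e p)))) [] []
node-rule (□-node {β = β} e p)  = □R (sub (closure e) β) [] []
node-rule (fix-node {q = q} {φ} e p) = fixR q (sub (lift-sub (closure e)) φ) [] []

node-next : ∀ {S} (n : Node S) (i : Premise (node-rule n)) → Node (premise (node-rule n) i)
node-next (⋀-node e ps) (α , α∈) = enter-∈ e ps α∈
node-next (⋁-node e p)  _        = enter e (proj₁ (proj₂ (witness e p))) refl
node-next (□-node e p)  _        = enter e p refl
node-next (fix-node {q = q} {φ} e p) _ = enter (bind e q φ p) p (unfold-sub q φ (closure e))

derivation : ∀ {α} → Provable [] α → Derivation (goal α)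
derivation {α} p = record
  { Node = Node
  ; root = enter [] p (sym (sub-id (λ ()) α))
  ; rule = node-rule
  ; next = node-next
  }

principal-occ : ∀ {S} → Node S → Occ (right S)
principal-occ (⋀-node e ps)  = _ , here refl
principal-occ (⋁-node e p)   = _ , here refl
principal-occ (□-node e p)   = _ , here refl
principal-occ (fix-node e p) = _ , here refl

principal-occ-goal : ∀ {α} (n : Node (goal α)) → principal-occ n ≡ (α , here refl)
principal-occ-goal (⋀-node e ps)  = refl
principal-occ-goal (⋁-node e p)   = refl
principal-occ-goal (□-node e p)   = refl
principal-occ-goal (fix-node e p) = refl

node-constructive : ∀ {S} → Node S → length (right S) ≤ 1
node-constructive (⋀-node e ps)  = ≤-refl
node-constructive (⋁-node e p)   = ≤-refl
node-constructive (□-node e p)   = ≤-refl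
node-constructive (fix-node e p) = ≤-refl

node-logical : ∀ {S} (n : Node S) → Logical (node-rule n)
node-logical (⋀-node e ps)  = tt
node-logical (⋁-node e p)   = tt
node-logical (□-node e p)   = tt
node-logical (fix-node e p) = tt

next-linked : ∀ {S} (n : Node S) (i : Premise (node-rule n)) →
              link right-side (node-rule n) i advance (principal-occ n) (principal-occ (node-next n i))
next-linked (⋀-node e ps) (α , α∈)
  rewrite principal-occ-goal (enter-∈ e ps α∈) = principal
next-linked (⋁-node e p) i
  rewrite principal-occ-goal (node-next (⋁-node e p) i) = principal
next-linked (□-node e p) i
  rewrite principal-occ-goal (node-next (□-node e p) i) = strip-head
next-linked (fix-node e p) i
  rewrite principal-occ-goal (node-next (fix-node e p) i) = principal

next-descends : ∀ {S} (n : Node S) (i : Premise (node-rule n)) →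
                proj₁ (principal-occ (node-next n i)) ◁ proj₁ (principal-occ n)
next-descends (⋀-node e ps) (α , α∈)
  rewrite principal-occ-goal (enter-∈ e ps α∈) = ⋀-sub α∈
next-descends (⋁-node e p) i
  rewrite principal-occ-goal (node-next (⋁-node e p) i) = ⋁-sub (proj₂ (proj₂ (proj₂ (witness e p))))
next-descends (□-node e p) i
  rewrite principal-occ-goal (node-next (□-node e p) i) = □-sub
next-descends (fix-node e p) i
  rewrite principal-occ-goal (node-next (fix-node e p) i) = fix-sub

-- Analysing a branch: under double negation, either a ν-formula of least complexity
-- recurs, or the branch comes back to one of the enclosing quantifiers.
module BranchAnalysis {α : Formula} (p₀ : Provable [] α) (b : Derivation.Branch (derivation p₀)) where
  open Derivation (derivation p₀) using (_↝_; step)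
  open Derivation.Branch b

  formula : ℕ → Formula
  formula t = proj₁ (principal-occ (proj₂ (node t)))

  -- A bound from some time on is what the returns to a fixpoint supply; `carries` turns it into
  -- minimality among the recurring formulas.
  Wins : Set
  Wins = ∃[ φ ] InfinitelyOften (λ t → formula t ≡ fix ν φ) ×
         ∃[ t ] (∀ u → t ≤ u → complexity (fix ν φ) ≤ complexity (formula u))

  AtLeast : Formula → ℕ → ℕ → Set
  AtLeast α t t′ = ∀ u → t ≤ u → u ≤ t′ → complexity α ≤ complexity (formula u)

  -- The lower bound on complexity covers the whole detour, so that consecutive detours from an
  -- outer fixpoint can be joined.
  LoopsBack : ∀ {Q : Vec Quantifier n} → Scope Q → Fml n → ℕ → Set
  LoopsBack {Q = Q} e β t = ∃[ t′ ] t ≤ t′ × ∃[ i ] Free i β × lookup Q i ≡ ν ×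
    node t′ ≡ (goal (closure e i) , loop e i) × AtLeast (closure e i) t t′

  successor : ∀ {S} {n : Node S} {t} → node t ≡ (S , n) →
              ∃[ i ] node (suc t) ≡ (premise (node-rule n) i , node-next n i)
  successor {t = t} eq with node t | node (suc t) | steps t
  successor refl | _ | _ | step n i = i , refl

  formula-at : ∀ {α t} {n : Node (goal α)} → node t ≡ (goal α , n) → formula t ≡ α
  formula-at {n = n} eq rewrite eq = cong proj₁ (principal-occ-goal n)

  AtLeast-step : ∀ {α t t′} → complexity α ≤ complexity (formula t) → AtLeast α (suc t) t′ →
                 AtLeast α t t′
  AtLeast-step {t = t} α≤ rest u t≤u u≤t′ with suc t ≤? u
  ... | yes t<u = rest u t<u u≤t′
  ... | no t≮u rewrite ≤-antisym (≮⇒≥ t≮u) t≤u = α≤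

  descend : ∀ {Q : Vec Quantifier n} (e : Scope Q) {β β′ t} → (∀ {i} → Free i β′ → Free i β) →
            formula t ≡ sub (closure e) β → LoopsBack e β′ (suc t) → LoopsBack e β t
  descend e ⊆β eq (t′ , t<t′ , i , fr , i≡ν , at , least) =
    t′ , <⇒≤ t<t′ , i , ⊆β fr , i≡ν , at ,
    AtLeast-step (subst (λ γ → _ ≤ complexity γ) (sym eq) (free-≤ (closure e) (⊆β fr))) least

  -- Induction on the evidence `p`, not on time: the body of a fixpoint has smaller evidence and is
  -- analysed afresh at each return. Whether the branch returns forever is not decidable, hence the
  -- double negation.
  analyse : ∀ {Q : Vec Quantifier n} {β α t} (p : Provable Q β) (e : Scope Q)
            (eq : α ≡ sub (closure e) β) → node t ≡ (goal α , enter e p eq) →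
            ¬ ¬ (Wins ⊎ LoopsBack e β t)
  analyse-∈ : ∀ {Q : Vec Quantifier n} {Γ α t} (ps : All (Provable Q) Γ) (e : Scope Q)
              (α∈ : α ∈ subs (closure e) Γ) → node t ≡ (goal α , enter-∈ e ps α∈) →
              ¬ ¬ (Wins ⊎ ∃[ β ] β ∈ Γ × LoopsBack e β t)
  analyse-any : ∀ {Q : Vec Quantifier n} {Γ t} (p : Any (Provable Q) Γ) (e : Scope Q) →
                node t ≡ (_ , enter e (proj₁ (proj₂ (witness e p))) refl) →
                ¬ ¬ (Wins ⊎ LoopsBack e (proj₁ (witness e p)) t)
  analyse-∈ (p ∷ ps) e (here eq) at k = analyse p e eq at λ
    { (inj₁ w) → k (inj₁ w) ; (inj₂ l) → k (inj₂ (_ , here refl , l)) }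
  analyse-∈ (p ∷ ps) e (there α∈) at k = analyse-∈ ps e α∈ at λ
    { (inj₁ w) → k (inj₁ w) ; (inj₂ (β , β∈ , l)) → k (inj₂ (β , there β∈ , l)) }
  analyse-any (here p)  e at = analyse p e refl at
  analyse-any (there p) e at = analyse-any p e at
  analyse {t = t} (var {i} i≡ν) e refl at k = k (inj₂ (t , ≤-refl , i , var , i≡ν , at ,
    λ u t≤u u≤t → ≤-reflexive (cong complexity
      (sym (trans (cong formula (≤-antisym u≤t t≤u)) (formula-at at))))))
  analyse (⋀ ps) e refl at k with successor at
  ... | (α , α∈) , at′ = analyse-∈ ps e α∈ at′ λ
    { (inj₁ w) → k (inj₁ w) ; (inj₂ (β , β∈ , l)) → k (inj₂ (descend e (⋀ β∈) (formula-at at) l)) }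
  analyse (⋁ p) e refl at k with successor at
  ... | _ , at′ = analyse-any p e at′ λ
    { (inj₁ w) → k (inj₁ w)
    ; (inj₂ l) → k (inj₂ (descend e (⋁ (proj₁ (proj₂ (proj₂ (witness e p))))) (formula-at at) l)) }
  analyse (□ p) e refl at k with successor at
  ... | _ , at′ = analyse p e refl at′ λ
    { (inj₁ w) → k (inj₁ w) ; (inj₂ l) → k (inj₂ (descend e □ (formula-at at) l)) }
  analyse {Q = Q} {t = t} (fix {q} {φ} p) e refl at k = wins q refl
    where
    ψ : Formula
    ψ = sub (closure e) (fix q φ)

    Returns : ℕ → Set
    Returns s = t ≤ s × node s ≡ (goal ψ , fix-node e p) × AtLeast ψ t s

    extend : ∀ {γ s s′} → complexity γ ≤ complexity ψ → AtLeast ψ t s → AtLeast γ (suc s) s′ →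
             AtLeast γ t s′
    extend {s = s} γ≤ψ before after u t≤u u≤s′ with suc s ≤? u
    ... | yes s<u = after u s<u u≤s′
    ... | no s≮u  = ≤-trans γ≤ψ (before u t≤u (≮⇒≥ s≮u))

    -- A win inside the body and a return to an outer fixpoint both answer the outer goal `k`. What
    -- remains is a strictly later return to `ψ`, and the value of the variable it passes through
    -- forces a `ν`.
    again : ∀ {s} → Returns s → ¬ ¬ (q ≡ ν × ∃[ s′ ] s < s′ × Returns s′)
    again {s} (t≤s , at-s , least) k′ with successor at-s
    ... | _ , at′ = analyse p (bind e q φ p) (unfold-sub q φ (closure e)) at′ λ
      { (inj₁ w) → k (inj₁ w)
      ; (inj₂ (s′ , s<s′ , zero , fr , q≡ν , at-s′ , least′)) →
          k′ (q≡ν , s′ , s<s′ , ≤-trans t≤s (<⇒≤ s<s′) , at-s′ , extend {ψ} ≤-refl least least′)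
      ; (inj₂ (s′ , s<s′ , suc i , fr , i≡ν , at-s′ , least′)) →
          k (inj₂ (s′ , ≤-trans t≤s (<⇒≤ s<s′) , i , fix fr , i≡ν , at-s′ ,
                   extend (<⇒≤ (free-fix-< (closure e) {q = q} (fix fr))) least least′)) }

    returns : ∀ m → ¬ ¬ (∃[ s ] m ≤ s × Returns s)
    returns zero    k′ = k′ (t , z≤n , ≤-refl , at , λ u t≤u u≤t →
      ≤-reflexive (cong complexity (sym (trans (cong formula (≤-antisym u≤t t≤u)) (formula-at at)))))
    returns (suc m) k′ = returns m λ { (s , m≤s , r) →
      again r λ { (_ , s′ , s<s′ , r′) → k′ (s′ , ≤-<-trans m≤s s<s′ , r′) } }

    wins : ∀ q′ → q ≡ q′ → ⊥
    -- A `μ` cannot be returned to, so one pass through the body already answers `k`.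
    wins μ refl = returns 0 λ { (_ , _ , r) → again r λ { (() , _) } }
    wins ν refl = k (inj₁ (_ ,
      (λ m k′ → returns m λ { (s , m≤s , _ , at-s , _) → k′ (s , m≤s , formula-at at-s) }) ,
      -- The bound at `u` is read off a return at or after `u`; being decidable, it sheds the double
      -- negation.
      t , λ u t≤u → decidable-stable (_ ≤? _) λ k′ →
        returns u λ { (s , u≤s , _ , _ , least) → k′ (least u t≤u u≤s) }))

  -- The trace of principal formulas and its thread

  trace : Trace {d = derivation p₀} right-side b
  trace = record
    { occ    = λ i → principal-occ (proj₂ (node i))
    ; kind   = λ _ → advance
    ; linked = λ i → linked (steps i)
    }
    where
    linked : ∀ {x y} (s : x ↝ y) → Derivation.link↝ (derivation p₀) right-side s advance
             (principal-occ (proj₂ x)) (principal-occ (proj₂ y))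
    linked (step n i) = next-linked n i

  thread : Thread
  thread = record { formula = formula ; descends = λ i → descends (steps i) }
    where
    descends : ∀ {x y} → x ↝ y → proj₁ (principal-occ (proj₂ y)) ◁ proj₁ (principal-occ (proj₂ x))
    descends (step n i) = next-descends n i

  position-trace : ∀ i → position trace i ≡ i
  position-trace zero    = refl
  position-trace (suc i) = cong suc (position-trace i)

  carries : Wins → Carries {d = derivation p₀} right-side ν b
  carries (φ , recurs , t , least) = trace , thread ,
    ((λ i → cong formula (sym (position-trace i))) ,
     λ k → k , ≤-reflexive (sym (position-trace k))) ,
    φ , recurs , λ β recursβ → decidable-stable (_ ≤? _) λ k →
      recursβ t λ { (u , t≤u , eq) → k (subst (λ γ → _ ≤ complexity γ) eq (least u t≤u)) }

  winning : ¬ ¬ Wins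
  -- No variable is in scope at the root, so there is nothing to loop back to.
  winning k = analyse p₀ [] _ start λ { (inj₁ w) → k w ; (inj₂ (_ , _ , () , _)) }

provable⇒⊩ : ∀ {α} → Provable [] α → [] ⊩ α
provable⇒⊩ p = derivation p ,
  (λ b → (λ k c → c (k , ≤-refl , node-logical (proj₂ (Derivation.Branch.node b k)))) ,
         λ k → BranchAnalysis.winning p b λ w → k (inj₂ (BranchAnalysis.carries p b w))) ,
  λ n _ → node-constructive n

-- Subterms and dual formulas

infix 4 _⊑_

-- χ ⊑ β : χ occurs in β outside the scope of the binders on which χ depends.
data _⊑_ {n} : Fml n → Fml n → Set where
  refl : ∀ {β} → β ⊑ β
  ⋀    : ∀ {χ β Γ} → β ∈ Γ → χ ⊑ β → χ ⊑ ⋀ Γ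
  ⋁    : ∀ {χ β Γ} → β ∈ Γ → χ ⊑ β → χ ⊑ ⋁ Γ
  □    : ∀ {χ β} → χ ⊑ β → χ ⊑ □ β
  ◇    : ∀ {χ β} → χ ⊑ β → χ ⊑ ◇ β
  fix  : ∀ {χ q φ} → ren suc χ ⊑ φ → χ ⊑ fix q φ

complexity-sub-ren-suc : (σ : Fin m → Fml n) (χ : Fml m) →
                         complexity (sub (lift-sub σ) (ren suc χ)) ≡ complexity (sub σ χ)
complexity-sub-ren-suc σ χ = trans (cong complexity (sub-suc-lift σ χ)) (complexity-ren suc (sub σ χ))

⊑-≤ : (σ : Fin m → Fml n) {χ β : Fml m} → χ ⊑ β → complexity (sub σ χ) ≤ complexity (sub σ β)
⊑-≤ σ refl        = ≤-refl
⊑-≤ σ (⋀ β∈Γ occ) = ≤-trans (⊑-≤ σ occ) (complexity-∈-subs σ β∈Γ)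
⊑-≤ σ (⋁ β∈Γ occ) = ≤-trans (⊑-≤ σ occ) (complexity-∈-subs σ β∈Γ)
⊑-≤ σ (□ occ)     = m≤n⇒m≤1+n (⊑-≤ σ occ)
⊑-≤ σ (◇ occ)     = m≤n⇒m≤1+n (⊑-≤ σ occ)
⊑-≤ σ (fix {χ} {φ = φ} occ) = m≤n⇒m≤1+n
  (subst (_≤ complexity (sub (lift-sub σ) φ)) (complexity-sub-ren-suc σ χ) (⊑-≤ (lift-sub σ) occ))

⊑-fix-< : (σ : Fin m → Fml n) {q : Quantifier} {χ : Fml m} {φ : Fml (suc m)} → ren suc χ ⊑ φ →
          complexity (sub σ χ) < complexity (sub σ (fix q φ))
⊑-fix-< σ {χ = χ} {φ} occ = s≤s
  (subst (_≤ complexity (sub (lift-sub σ) φ)) (complexity-sub-ren-suc σ χ) (⊑-≤ (lift-sub σ) occ))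

-- Abstracts the situation of `suc` and `zero` to a form that survives `lift-ren`, as the recursion
-- under binders requires.
Covers : (Fin m → Fin n) → Fin n → Set
Covers f i = ∀ j → j ≡ i ⊎ ∃[ l ] f l ≡ j

covers-lift : {f : Fin m → Fin n} {i : Fin n} → Covers f i → Covers (lift-ren f) (suc i)
covers-lift cov zero    = inj₂ (zero , refl)
covers-lift cov (suc j) with cov j
... | inj₁ refl       = inj₁ refl
... | inj₂ (l , refl) = inj₂ (suc l , refl)

strengthen : {f : Fin m → Fin n} {i : Fin n} → Covers f i →
             ∀ χ → Free i χ ⊎ ∃[ χ′ ] ren f χ′ ≡ χ
strengthens : {f : Fin m → Fin n} {i : Fin n} → Covers f i →
              ∀ Γ → (∃[ β ] β ∈ Γ × Free i β) ⊎ ∃[ Γ′ ] rens f Γ′ ≡ Γ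
strengthen cov (lit l) = inj₂ (lit l , refl)
strengthen cov (var j) with cov j
... | inj₁ refl       = inj₁ var
... | inj₂ (l , refl) = inj₂ (var l , refl)
strengthen cov (⋀ Γ) with strengthens cov Γ
... | inj₁ (_ , β∈Γ , fr) = inj₁ (⋀ β∈Γ fr)
... | inj₂ (Γ′ , refl)    = inj₂ (⋀ Γ′ , refl)
strengthen cov (⋁ Γ) with strengthens cov Γ
... | inj₁ (_ , β∈Γ , fr) = inj₁ (⋁ β∈Γ fr)
... | inj₂ (Γ′ , refl)    = inj₂ (⋁ Γ′ , refl)
strengthen cov (□ β) with strengthen cov β
... | inj₁ fr          = inj₁ (□ fr)
... | inj₂ (β′ , refl) = inj₂ (□ β′ , refl)
strengthen cov (◇ β) with strengthen cov β
... | inj₁ fr          = inj₁ (◇ fr)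
... | inj₂ (β′ , refl) = inj₂ (◇ β′ , refl)
strengthen cov (fix q φ) with strengthen (covers-lift cov) φ
... | inj₁ fr          = inj₁ (fix fr)
... | inj₂ (φ′ , refl) = inj₂ (fix q φ′ , refl)
strengthens cov [] = inj₂ ([] , refl)
strengthens cov (β ∷ Γ) with strengthen cov β | strengthens cov Γ
... | inj₁ fr          | _                   = inj₁ (β , here refl , fr)
... | inj₂ _           | inj₁ (γ , γ∈Γ , fr) = inj₁ (γ , there γ∈Γ , fr)
... | inj₂ (β′ , refl) | inj₂ (Γ′ , refl)    = inj₂ (β′ ∷ Γ′ , refl)

free-zero⊎weakened : (χ : Fml (suc n)) → Free zero χ ⊎ ∃[ χ′ ] ren suc χ′ ≡ χ
free-zero⊎weakened = strengthen λ { zero → inj₁ refl ; (suc j) → inj₂ (j , refl) }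

◇-injective : {β γ : Fml n} → ◇ β ≡ ◇ γ → β ≡ γ
◇-injective refl = refl

dual-ren : (f : Fin m → Fin n) (β : Fml m) → dual (ren f β) ≡ ren f (dual β)
duals-rens : (f : Fin m → Fin n) (Γ : List (Fml m)) → duals (rens f Γ) ≡ rens f (duals Γ)
dual-ren f (lit l)   = refl
dual-ren f (var i)   = refl
dual-ren f (⋀ Γ)     = cong ⋁ (duals-rens f Γ)
dual-ren f (⋁ Γ)     = cong ⋀ (duals-rens f Γ)
dual-ren f (□ β)     = cong ◇ (dual-ren f β)
dual-ren f (◇ β)     = cong □ (dual-ren f β)
dual-ren f (fix q β) = cong (fix (dualᑫ q)) (dual-ren (lift-ren f) β)
duals-rens f []      = refl
duals-rens f (β ∷ Γ) = cong₂ _∷_ (dual-ren f β) (duals-rens f Γ)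

dual-sub : {σ τ : Fin m → Fml n} → (∀ i → dual (σ i) ≡ τ i) →
           ∀ β → dual (sub σ β) ≡ sub τ (dual β)
duals-subs : {σ τ : Fin m → Fml n} → (∀ i → dual (σ i) ≡ τ i) →
             ∀ Γ → duals (subs σ Γ) ≡ subs τ (duals Γ)
dual-sub eq (lit l)   = refl
dual-sub eq (var i)   = eq i
dual-sub eq (⋀ Γ)     = cong ⋁ (duals-subs eq Γ)
dual-sub eq (⋁ Γ)     = cong ⋀ (duals-subs eq Γ)
dual-sub eq (□ β)     = cong ◇ (dual-sub eq β)
dual-sub eq (◇ β)     = cong □ (dual-sub eq β)
dual-sub {σ = σ} eq (fix q β) = cong (fix (dualᑫ q)) (dual-sub
  (λ { zero → refl ; (suc i) → trans (dual-ren suc (σ i)) (cong (ren suc) (eq i)) }) β)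
duals-subs eq []      = refl
duals-subs eq (β ∷ Γ) = cong₂ _∷_ (dual-sub eq β) (duals-subs eq Γ)

dual-involutive : (β : Fml n) → dual (dual β) ≡ β
duals-involutive : (Γ : List (Fml n)) → duals (duals Γ) ≡ Γ
dual-involutive (lit (pos x)) = refl
dual-involutive (lit (neg x)) = refl
dual-involutive (var i)       = refl
dual-involutive (⋀ Γ)         = cong ⋀ (duals-involutive Γ)
dual-involutive (⋁ Γ)         = cong ⋁ (duals-involutive Γ)
dual-involutive (□ β)         = cong □ (dual-involutive β)
dual-involutive (◇ β)         = cong ◇ (dual-involutive β)
dual-involutive (fix μ β)     = cong (fix μ) (dual-involutive β)
dual-involutive (fix ν β)     = cong (fix ν) (dual-involutive β)
duals-involutive []           = refl
duals-involutive (β ∷ Γ)      = cong₂ _∷_ (dual-involutive β) (duals-involutive Γ)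

dual-∈ : {β : Fml n} {Γ : List (Fml n)} → β ∈ Γ → dual β ∈ duals Γ
dual-∈ (here refl) = here refl
dual-∈ (there p)   = there (dual-∈ p)

dual-unfold : ∀ q (φ : Fml (suc n)) → dual (unfold q φ) ≡ unfold (dualᑫ q) (dual φ)
dual-unfold q φ = dual-sub (λ { zero → refl ; (suc i) → refl }) φ

dual-◁ : ∀ {α β} → α ◁ β → dual α ◁ dual β
dual-◁ (⋀-sub α∈Γ) = ⋁-sub (dual-∈ α∈Γ)
dual-◁ (⋁-sub α∈Γ) = ⋀-sub (dual-∈ α∈Γ)
dual-◁ □-sub       = ◇-sub
dual-◁ ◇-sub       = □-sub
dual-◁ (fix-sub {q} {φ}) = subst (_◁ dual (fix q φ)) (sym (dual-unfold q φ)) fix-sub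

dual-subformula : ∀ {α β} → Subformula α β → Subformula (dual α) (dual β)
dual-subformula ε        = ε
dual-subformula (s ◅ ss) = dual-◁ s ◅ dual-subformula ss

-- Disjunctions of conjunctive formulas

data Modal : Formula → Set where
  lit : ∀ l → Modal (lit l)
  □   : ∀ γ → Modal (□ γ)
  ◇   : ∀ Δ → Modal (◇ (⋀ Δ))

-- The dual of a cover, seen from the countermodel. The field `bounded` comes from `Γ ⊆ Δ`: a world
-- refuting `γ` refutes the conjunction under the `◇` as well.
record CoCover (Θ : List Formula) : Set where
  field
    modal      : ∀ {β} → β ∈ Θ → Modal β
    consistent : ∀ {x} → lit (pos x) ∈ Θ → lit (neg x) ∉ Θ
    bounded    : ∀ {Δ γ} → ◇ (⋀ Δ) ∈ Θ → □ γ ∈ Θ → γ ∈ Δ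

data CoverMember (L : List Literal) (Γ Δ : List Formula) : Formula → Set where
  lit : ∀ {l} → l ∈ L → CoverMember L Γ Δ (lit l)
  ◇   : ∀ {γ} → γ ∈ Γ → CoverMember L Γ Δ (◇ γ)
  □   : CoverMember L Γ Δ (□ (⋁ Δ))

cover-member : ∀ {L Γ Δ β} → β ∈ cover L Γ Δ → CoverMember L Γ Δ β
cover-member {L} {Γ} β∈ with ∈-++⁻ (map lit L) β∈
... | inj₁ β∈L with ∈-map⁻ lit β∈L
...   | _ , l∈L , refl = lit l∈L
cover-member {L} {Γ} β∈ | inj₂ β∈′ with ∈-++⁻ (map ◇ Γ) β∈′
... | inj₂ (here refl) = □
... | inj₁ β∈Γ with ∈-map⁻ ◇ β∈Γ
...   | _ , γ∈Γ , refl = ◇ γ∈Γ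

isCover⇒coCover : ∀ {Θ} → IsCover (duals Θ) → CoCover Θ
isCover⇒coCover {Θ} (L , Γ , Δ , consistent , Γ⊆Δ , Θ∼) = record
  { modal      = λ {β} β∈ → subst Modal (dual-involutive β) (dual-modal (member β∈))
  ; consistent = λ p∈ n∈ → inconsistent (member p∈) (member n∈)
  ; bounded    = λ d∈ b∈ → in-tail (member d∈) (member b∈)
  }
  where
  member : ∀ {β} → β ∈ Θ → CoverMember L Γ Δ (dual β)
  member β∈ = cover-member (Equivalence.to Θ∼ (dual-∈ β∈))

  dual-modal : ∀ {β} → CoverMember L Γ Δ β → Modal (dual β)
  dual-modal (lit _) = lit _
  dual-modal (◇ _)   = □ _
  dual-modal □       = ◇ _

  inconsistent : ∀ {x} → CoverMember L Γ Δ (lit (neg x)) → ¬ CoverMember L Γ Δ (lit (pos x))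
  inconsistent (lit n∈L) (lit p∈L) = consistent _ (p∈L , n∈L)

  □-tail : ∀ {β} → CoverMember L Γ Δ (□ β) → β ≡ ⋁ Δ
  □-tail □ = refl

  ⋁-injective : ∀ {Θ Θ′ : List Formula} → ⋁ Θ ≡ ⋁ Θ′ → Θ ≡ Θ′
  ⋁-injective refl = refl

  -- A cover has a single `□`, so `Δ′` is the dual of `Δ`, and dualising `Γ ⊆ Δ` gives the
  -- membership.
  in-tail : ∀ {Δ′ γ} → CoverMember L Γ Δ (dual (◇ (⋀ Δ′))) → CoverMember L Γ Δ (dual (□ γ)) → γ ∈ Δ′
  in-tail {Δ′} {γ} d (◇ γ∈Γ) =
    subst (_∈ Δ′) (dual-involutive γ)
      (subst (dual (dual γ) ∈_) (trans (cong duals (sym (⋁-injective (□-tail d)))) (duals-involutive Δ′))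
        (dual-∈ (Γ⊆Δ γ∈Γ)))

-- Cyclic refutations of closed formulas

-- Λ holds the bodies of the μ-formulas to which a loop may return.
below : Formula → List (Fml 1) → List (Fml 1)
below ψ = filter (λ φ → complexity (fix μ φ) <? complexity ψ)

∈-below⁺ : ∀ ψ {φ Λ} → φ ∈ Λ → complexity (fix μ φ) < complexity ψ → φ ∈ below ψ Λ
∈-below⁺ ψ = ∈-filter⁺ (λ φ → complexity (fix μ φ) <? complexity ψ)

∈-below⁻ : ∀ ψ Λ {φ} → φ ∈ below ψ Λ → φ ∈ Λ × complexity (fix μ φ) < complexity ψ
∈-below⁻ ψ Λ = ∈-filter⁻ (λ φ → complexity (fix μ φ) <? complexity ψ) {xs = Λ}

-- Unfolding ψ discards the returns to formulas of complexity at least that of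
-- ψ, so that a loop returning to fix μ φ only meets more complex fixpoints.
data Refutation (Λ : List (Fml 1)) : Formula → Set where
  return : ∀ {φ} → φ ∈ Λ → Refutation Λ (fix μ φ)
  lit    : ∀ l → Refutation Λ (lit l)
  ⋀      : ∀ {γ Γ} → γ ∈ Γ → Refutation Λ γ → Refutation Λ (⋀ Γ)
  ⋁      : ∀ {Θ} → CoCover Θ → (∀ {γ} → □ γ ∈ Θ → Refutation Λ γ) → Refutation Λ (⋁ Θ)
  □      : ∀ {γ} → Refutation Λ γ → Refutation Λ (□ γ)
  ◇      : ∀ γ → Refutation Λ (◇ γ)
  fix-μ  : ∀ {φ} → φ ∉ Λ → Refutation (φ ∷ below (fix μ φ) Λ) (unfold μ φ) → Refutation Λ (fix μ φ)
  fix-ν  : ∀ {φ} → Refutation (below (fix ν φ) Λ) (unfold ν φ) → Refutation Λ (fix ν φ)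

module _ {α : Formula} (conjunctive : Conjunctive α) where

  Returnable : Vec Quantifier n → List (Fml 1) → (Fin n → Formula) → Fml n → Set
  Returnable Q Λ σ β = ∀ {i} → Free i β → lookup Q i ≡ μ → ∃[ φ ] σ i ≡ fix μ φ × φ ∈ Λ

  IsFix : Formula → Set
  IsFix ψ = ∃[ q ] ∃[ φ ] ψ ≡ fix q φ

  -- A variable still free in the fixpoint stands for a less complex formula, so its return survives
  -- `below`.
  returnable-body : ∀ (Q : Vec Quantifier n) {Λ} {σ : Fin n → Formula} q {φ} →
                    Returnable Q Λ σ (fix q φ) →
                    ∀ {i} → Free (suc i) φ → lookup Q i ≡ μ →
                    ∃[ χ ] σ i ≡ fix μ χ × χ ∈ below (sub σ (fix q φ)) Λ
  returnable-body Q {σ = σ} q {φ} ret fr i≡μ =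
    let χ , eq , χ∈Λ = ret (fix fr) i≡μ
    in χ , eq , ∈-below⁺ (sub σ (fix q φ)) χ∈Λ
         (subst (λ ξ → complexity ξ < complexity (sub σ (fix q φ))) eq
         (free-fix-< σ {q = q} (fix fr)))

  cyclic : ∀ {Q : Vec Quantifier n} {β Λ} (σ : Fin n → Formula) → Refutable Q β →
           (∀ i → IsFix (σ i)) → Returnable Q Λ σ β → Subformula (sub σ β) α →
           ¬ ¬ Refutation Λ (sub σ β)
  cyclic-any : ∀ {Q : Vec Quantifier n} {Γ Λ} (σ : Fin n → Formula) → Any (Refutable Q) Γ →
               (∀ i → IsFix (σ i)) → (∀ {β} → β ∈ Γ → Returnable Q Λ σ β) →
               (∀ {β} → β ∈ Γ → Subformula (sub σ β) α) →
               ¬ ¬ (∃[ γ ] γ ∈ subs σ Γ × Refutation Λ γ)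
  cyclic-all : ∀ {Q : Vec Quantifier n} {Γ Λ} (σ : Fin n → Formula) → All (Refutable Q) Γ →
               (∀ i → IsFix (σ i)) → (∀ {β} → β ∈ Γ → Returnable Q Λ σ β) →
               (∀ {β} → β ∈ Γ → Subformula (sub σ β) α) →
               ¬ ¬ (∀ {γ} → γ ∈ subs σ Γ → Refutation Λ γ)
  cyclic {Λ = Λ} σ (var {i} i≡μ) fixed ret sf k =
    let φ , eq , φ∈Λ = ret var i≡μ in k (subst (Refutation Λ) (sym eq) (return φ∈Λ))
  cyclic σ lit fixed ret sf k = k (lit _)
  cyclic σ (⋀ r) fixed ret sf k =
    cyclic-any σ r fixed (λ β∈ fr → ret (⋀ β∈ fr)) (λ β∈ → ⋀-sub (∈-subs⁺ σ β∈) ◅ sf)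
      λ { (γ , γ∈ , r′) → k (⋀ γ∈ r′) }
  cyclic {Λ = Λ} σ (⋁ rs) fixed ret sf k =
    cyclic-all σ rs fixed (λ β∈ fr → ret (⋁ β∈ fr)) (λ β∈ → ⋁-sub (∈-subs⁺ σ β∈) ◅ sf)
      -- The dual of this disjunction is a conjunction and lies below `dual α`, hence it is a cover.
      λ rs′ → k (⋁ (isCover⇒coCover (conjunctive _ (dual-subformula sf))) λ γ∈ → unbox (rs′ γ∈))
    where
    unbox : ∀ {γ} → Refutation Λ (□ γ) → Refutation Λ γ
    unbox (□ r) = r
  cyclic σ (□ r) fixed ret sf k =
    cyclic σ r fixed (λ fr → ret (□ fr)) (□-sub ◅ sf) λ r′ → k (□ r′)
  cyclic σ ◇ fixed ret sf k = k (◇ _)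
  -- The test concerns the closed body: if it is already returnable, the loop closes at once, even
  -- when another binder gave rise to it.
  cyclic {Q = Q} {Λ = Λ} σ (fix {μ} {φ} r) fixed ret sf k = ¬¬-excluded-middle λ
    { (yes φ∈Λ) → k (return φ∈Λ)
    ; (no φ∉Λ)  → cyclic (sub σ (fix μ φ) ▹ σ) r (λ { zero → _ , _ , refl ; (suc i) → fixed i })
        (λ { {zero} fr _ → _ , refl , here refl
           ; {suc i} fr i≡μ →
               let χ , eq , χ∈ = returnable-body Q μ ret fr i≡μ in χ , eq , there χ∈ })
        (subst (λ ξ → Subformula ξ α) (unfold-sub μ φ σ) (fix-sub ◅ sf))
        λ r′ → k (fix-μ φ∉Λ (subst (Refutation _) (sym (unfold-sub μ φ σ)) r′)) }
  cyclic {Q = Q} {Λ = Λ} σ (fix {ν} {φ} r) fixed ret sf k =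
    cyclic (sub σ (fix ν φ) ▹ σ) r (λ { zero → _ , _ , refl ; (suc i) → fixed i })
      (λ { {zero} fr () ; {suc i} fr i≡μ → returnable-body Q ν ret fr i≡μ })
      (subst (λ ξ → Subformula ξ α) (unfold-sub ν φ σ) (fix-sub ◅ sf))
      λ r′ → k (fix-ν (subst (Refutation _) (sym (unfold-sub ν φ σ)) r′))
  cyclic-any σ (here r) fixed ret sf k =
    cyclic σ r fixed (ret (here refl)) (sf (here refl)) λ r′ → k (_ , here refl , r′)
  cyclic-any σ (there r) fixed ret sf k =
    cyclic-any σ r fixed (λ β∈ → ret (there β∈)) (λ β∈ → sf (there β∈))
      λ { (γ , γ∈ , r′) → k (γ , there γ∈ , r′) }
  cyclic-all σ [] fixed ret sf k = k λ ()
  cyclic-all σ (r ∷ rs) fixed ret sf k =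
    cyclic σ r fixed (ret (here refl)) (sf (here refl)) λ r′ →
    cyclic-all σ rs fixed (λ β∈ → ret (there β∈)) (λ β∈ → sf (there β∈)) λ rs′ →
    k λ { (here refl) → r′ ; (there γ∈) → rs′ γ∈ }

-- The countermodel of a refutation

-- A position in the cyclic refutation with an environment of the states its loops return to. The
-- type is inductive, since environments contain only states built earlier.
data State : Set where
  state : ∀ {Λ ψ} → Refutation Λ ψ → (∀ φ → φ ∈ Λ → State) → State

Returns : List (Fml 1) → Set
Returns Λ = ∀ φ → φ ∈ Λ → State

restrict : ∀ ψ {Λ} → Returns Λ → Returns (below ψ Λ)
restrict ψ {Λ} η φ φ∈ = η φ (proj₁ (∈-below⁻ ψ Λ φ∈))

push : ∀ {φ Λ} → State → Returns Λ → Returns (φ ∷ Λ)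
push s η φ (here _)   = s
push s η φ (there φ∈) = η φ φ∈

infix 4 _⇝_ _⇝*_

-- The moves that stay in the current world.
data _⇝_ : State → State → Set where
  return : ∀ {Λ φ} {φ∈ : φ ∈ Λ} {η : Returns Λ} → state (return φ∈) η ⇝ η φ φ∈
  ⋀      : ∀ {Λ γ Γ} {γ∈ : γ ∈ Γ} {r : Refutation Λ γ} {η : Returns Λ} →
           state (⋀ γ∈ r) η ⇝ state r η
  fix-μ  : ∀ {Λ φ} {φ∉ : φ ∉ Λ} {r : Refutation (φ ∷ below (fix μ φ) Λ) (unfold μ φ)}
           {η : Returns Λ} →
           state (fix-μ φ∉ r) η ⇝ state r (push (state (fix-μ φ∉ r) η) (restrict (fix μ φ) η))
  fix-ν  : ∀ {Λ φ} {r : Refutation (below (fix ν φ) Λ) (unfold ν φ)} {η : Returns Λ} →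
           state (fix-ν r) η ⇝ state r (restrict (fix ν φ) η)

_⇝*_ : State → State → Set
_⇝*_ = Star _⇝_

-- A refuted `◇` standing alone spawns nothing and fails for want of children, whereas each `□`
-- among the disjuncts gets a child of its own.
data Spawns : State → State → Set where
  □ : ∀ {Λ γ} {r : Refutation Λ γ} {η : Returns Λ} → Spawns (state (□ r) η) (state r η)
  ⋁ : ∀ {Λ Θ c} {rs : ∀ {γ} → □ γ ∈ Θ → Refutation Λ γ} {η : Returns Λ} {γ} (γ∈ : □ γ ∈ Θ) →
      Spawns (state (⋁ c rs) η) (state (rs γ∈) η)

data Falsifies : State → Literal → Set where
  lit : ∀ {Λ l} {η : Returns Λ} → Falsifies (state (lit l) η) l
  ⋁   : ∀ {Λ Θ c l} {rs : ∀ {γ} → □ γ ∈ Θ → Refutation Λ γ} {η : Returns Λ} → lit l ∈ Θ →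
        Falsifies (state (⋁ c rs) η) l

falsifies-consistent : ∀ {s x} → Falsifies s (pos x) → ¬ Falsifies s (neg x)
falsifies-consistent (⋁ {c = c} p∈) (⋁ n∈) = CoCover.consistent c p∈ n∈

Final : State → Set
Final s = ∀ {t} → ¬ (s ⇝ t)

spawns-final : ∀ {s t} → Spawns s t → Final s
spawns-final □      ()
spawns-final (⋁ γ∈) ()

falsifies-final : ∀ {s l} → Falsifies s l → Final s
falsifies-final lit    ()
falsifies-final (⋁ l∈) ()

⇝-deterministic : ∀ {s t u} → s ⇝ t → s ⇝ u → t ≡ u
⇝-deterministic return return = refl
⇝-deterministic ⋀      ⋀      = refl
⇝-deterministic fix-μ  fix-μ  = refl
⇝-deterministic fix-ν  fix-ν  = refl

-- Silent moves are deterministic, so a world has at most one state that settles its literals and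
-- children. A world whose moves go round forever has none.
final-unique : ∀ {s t u} → Final t → Final u → s ⇝* t → s ⇝* u → t ≡ u
final-unique ft fu ε        ε        = refl
final-unique ft fu ε        (m ◅ _)  = contradiction m ft
final-unique ft fu (m ◅ _)  ε        = contradiction m fu
final-unique ft fu (m ◅ ms) (l ◅ ls) with ⇝-deterministic m l
... | refl = final-unique ft fu ms ls

module Countermodel {α : Formula} (r₀ : Refutation [] α) where

  -- Worlds are histories of spawnings, which makes the frame a tree however the refutation loops. A
  -- history is extended from the states reachable at its end, hence the simultaneous recursion with
  -- `current`.
  data World : Set
  current : World → State

  data World where
    origin : World
    child  : ∀ (w : World) {t s} → current w ⇝* t → Spawns t s → World

  current origin                 = state r₀ λ _ ()
  current (child w {s = s} _ _)  = s

  data _⟶_ : World → World → Set where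
    edge : ∀ {w t s} (ms : current w ⇝* t) (sp : Spawns t s) → w ⟶ child w ms sp

  path : ∀ w → Star _⟶_ origin w
  path origin          = ε
  path (child w ms sp) = path w ◅◅ (edge ms sp ◅ ε)

  unique-parent : ∀ {u v w} → u ⟶ w → v ⟶ w → u ≡ v
  unique-parent (edge _ _) (edge _ _) = refl

  model : Model
  model = record
    { World       = World
    ; _⟶_         = _⟶_
    -- A variable holds exactly where its negation is to be falsified; elsewhere it is false by
    -- default.
    ; Val         = λ x w → ∃[ t ] current w ⇝* t × Falsifies t (neg x)
    ; root        = origin
    ; reachable   = path
    ; root-source = λ _ ()
    ; parent-uniq = unique-parent
    }

  open Semantics model

  -- An open formula β is read as sub σ β.  Different β with the same reading, such
  -- as a □-disjunct and the matching member of the ◇-disjunct of a cover, must be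
  -- refuted by the same state; this succeeds because returns to Λ are never spelt
  -- out in β but are always variables.
  Canonical : List (Fml 1) → Fml n → (Fin n → Formula) → Set
  Canonical Λ β σ = ∀ {χ} → fix μ χ ⊑ β → sub (lift-sub σ) χ ∉ Λ

  -- A μ-bound variable denotes the complement of the set of worlds that pass
  -- through the state to which its formula returns.
  data Bound {Λ} (η : Returns Λ) : Formula → (World → Set) → Set₁ where
    μ-bound : ∀ {φ X} → φ ∈ Λ → (∀ φ∈ v → current v ⇝* η φ φ∈ → ¬ X v) → Bound η (fix μ φ) X
    ν-bound : ∀ {n X} (φ : Fml (suc n)) (σ : Fin n → Formula) (ρ : Vector (World → Set) n) →
              (∀ v → X v → ⟦ φ ⟧ (X ▹ ρ) v) → Canonical Λ (fix ν φ) σ →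
              (∀ {i} → Free i (fix ν φ) → Bound η (σ i) (ρ i)) → Bound η (sub σ (fix ν φ)) X

  AllBound : ∀ {Λ} → Returns Λ → Fml n → (Fin n → Formula) → Vector (World → Set) n → Set₁
  AllBound η β σ ρ = ∀ {i} → Free i β → Bound η (σ i) (ρ i)

  -- Passing to Λ′ while unfolding ψ.
  record Unfolding (ψ : Formula) {Λ Λ′} (η : Returns Λ) (η′ : Returns Λ′) : Set where
    field
      keep : ∀ {φ} → complexity (fix μ φ) < complexity ψ → φ ∈ Λ → φ ∈ Λ′
      back : ∀ {φ} (φ∈ : φ ∈ Λ′) →
             (complexity (fix μ φ) < complexity ψ × Σ[ φ∈Λ ∈ φ ∈ Λ ] η′ φ φ∈ ≡ η φ φ∈Λ) ⊎
             fix μ φ ≡ ψ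

  unfolding-restrict : ∀ ψ {Λ} (η : Returns Λ) → Unfolding ψ η (restrict ψ η)
  unfolding-restrict ψ {Λ} η = record
    { keep = λ φ< φ∈ → ∈-below⁺ ψ φ∈ φ<
    ; back = λ φ∈ → inj₁ (proj₂ (∈-below⁻ ψ Λ φ∈) , _ , refl)
    }

  unfolding-push : ∀ {φ s Λ} (η : Returns Λ) →
                   Unfolding (fix μ φ) η (push {φ} s (restrict (fix μ φ) η))
  unfolding-push {φ} {Λ = Λ} η = record
    { keep = λ χ< χ∈ → there (∈-below⁺ (fix μ φ) χ∈ χ<)
    ; back = λ { (here refl) → inj₂ refl
               ; (there χ∈)  → inj₁ (proj₂ (∈-below⁻ (fix μ φ) Λ χ∈) , _ , refl) }
    }

  module _ {ψ Λ Λ′} {η : Returns Λ} {η′ : Returns Λ′} (unf : Unfolding ψ η η′) where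
    open Unfolding unf

    -- The returns added or dropped by the unfolding belong to formulas at least as complex as `ψ`,
    -- so the interpretation of a simpler formula is unaffected.
    bound-unfolding : ∀ {ξ X} → complexity ξ < complexity ψ → Bound η ξ X → Bound η′ ξ X
    bound-unfolding {ξ} {X} ξ<ψ (μ-bound {φ} φ∈ avoids) = μ-bound (keep ξ<ψ φ∈) avoids′
      where
      avoids′ : ∀ φ∈′ v → current v ⇝* η′ φ φ∈′ → ¬ X v
      avoids′ φ∈′ v ms with back φ∈′
      ... | inj₁ (_ , φ∈Λ , eq) = avoids φ∈Λ v (subst (current v ⇝*_) eq ms)
      ... | inj₂ refl           = contradiction ξ<ψ (<-irrefl refl)
    bound-unfolding {ξ} ξ<ψ (ν-bound φ σ ρ postfixed canonical bound) =
      ν-bound φ σ ρ postfixed canonical′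
        (λ fr → bound-unfolding (<-trans (free-fix-< σ fr) ξ<ψ) (bound fr))
      where
      canonical′ : Canonical Λ′ (fix ν φ) σ
      canonical′ occ χ∈ with back χ∈
      ... | inj₁ (_ , χ∈Λ , _) = canonical occ χ∈Λ
      ... | inj₂ eq            = <-irrefl refl
        (≤-<-trans (subst (λ ζ → complexity ζ ≤ complexity ξ) eq (⊑-≤ σ occ)) ξ<ψ)

    module _ {q} {φ : Fml (suc n)} {σ : Fin n → Formula} (ψ-fix : sub σ (fix q φ) ≡ ψ)
             (canonical : Canonical Λ (fix q φ) σ) where

      -- A fixpoint of the body that depends on the bound variable reads as something more complex
      -- than `ψ`, and no return in `Λ′` is that complex. Any other occurs already in the whole
      -- fixpoint, so it reads neither as a return in `Λ` nor, being less complex, as `ψ`.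
      canonical-body : Canonical Λ′ φ (ψ ▹ σ)
      canonical-body {χ} occ χ∈ with free-zero⊎weakened (fix μ χ) | back χ∈
      ... | inj₁ fr | inj₁ (χ<ψ , _) = <-irrefl refl (<-trans (free-fix-< (ψ ▹ σ) fr) χ<ψ)
      ... | inj₁ fr | inj₂ eq        =
        <-irrefl (cong complexity (sym eq)) (free-fix-< (ψ ▹ σ) fr)
      ... | inj₂ (fix μ χ′ , refl) | b =
        weakened b
        where
        eq′ : sub (lift-sub (ψ ▹ σ)) (ren (lift-ren suc) χ′) ≡ sub (lift-sub σ) χ′
        eq′ = sub-ren (λ { zero → refl ; (suc i) → refl }) χ′

        weakened : _ → ⊥
        weakened (inj₁ (_ , χ∈Λ , _)) = canonical (fix occ) (subst (_∈ Λ) eq′ χ∈Λ)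
        weakened (inj₂ eq) = <-irrefl
          (cong complexity (trans (sym (cong (fix μ) eq′)) (trans eq (sym ψ-fix))))
          (⊑-fix-< σ {q = q} occ)

      bound-body : ∀ {ρ X} → AllBound η (fix q φ) σ ρ → Bound η′ ψ X → AllBound η′ φ (ψ ▹ σ) (X ▹ ρ)
      bound-body bound b {zero}  fr = b
      bound-body bound b {suc i} fr = bound-unfolding
        (subst (λ ξ → complexity (σ i) < complexity ξ) ψ-fix (free-fix-< σ {q = q} (fix fr)))
        (bound (fix fr))

  -- Soundness of refutations in the countermodel

  Refutes : ∀ {Λ ψ} → Refutation Λ ψ → Set₁
  Refutes {Λ} {ψ} r = ∀ (η : Returns Λ) w → current w ⇝* state r η →
    ∀ {n} (β : Fml n) (σ : Fin n → Formula) (ρ : Vector (World → Set) n) → sub σ β ≡ ψ →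
    Canonical Λ β σ → AllBound η β σ ρ → ¬ ⟦ β ⟧ ρ w

  ⟦⟧⋀-∈ : ∀ {β : Fml n} {Γ ρ w} → β ∈ Γ → ⟦ Γ ⟧⋀ ρ w → ⟦ β ⟧ ρ w
  ⟦⟧⋀-∈ (here refl) (h , _)  = h
  ⟦⟧⋀-∈ (there β∈)  (_ , hs) = ⟦⟧⋀-∈ β∈ hs

  ⟦⟧⋁-∈ : ∀ {Γ : List (Fml n)} {ρ w} → ⟦ Γ ⟧⋁ ρ w → Σ[ β ∈ Fml n ] β ∈ Γ × ⟦ β ⟧ ρ w
  ⟦⟧⋁-∈ {Γ = _ ∷ _} (inj₁ h) = _ , here refl , h
  ⟦⟧⋁-∈ {Γ = _ ∷ _} (inj₂ h) = let β , β∈ , h′ = ⟦⟧⋁-∈ h in β , there β∈ , h′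

  bound-fix : ∀ {Λ} {η : Returns Λ} {ξ X} → Bound η ξ X → ∃[ q ] ∃[ φ ] ξ ≡ fix q φ
  bound-fix (μ-bound _ _)         = _ , _ , refl
  bound-fix (ν-bound _ _ _ _ _ _) = _ , _ , refl

  not-fix : ∀ {Λ} {η : Returns Λ} {ξ X ψ} → Bound η ξ X → ξ ≡ ψ → ¬ (∀ {q φ} → ψ ≢ fix q φ)
  not-fix b refl ψ≢fix = let _ , _ , eq = bound-fix b in ψ≢fix eq

  refutes-lit : ∀ {l t w} → current w ⇝* t → Falsifies t l → ∀ {n} {ρ : Vector (World → Set) n} →
                ¬ ⟦ lit l ⟧ ρ w
  refutes-lit {pos x} ms f (lift h) = h λ (t′ , ms′ , f′) → falsifies-consistent f
    (subst (λ u → Falsifies u (neg x))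
      (final-unique (falsifies-final f′) (falsifies-final f) ms′ ms) f′)
  refutes-lit {neg x} ms f (lift h) = h (_ , ms , f)

  -- The postfixed set interprets the bound variable in the body, and when that variable is met, a
  -- smaller refutation deals with it. Speaking of `X` covers both a `ν`-formula that is spelt out
  -- and one reached through a variable.
  refutes-ν : ∀ {Λ φ̂} {r : Refutation (below (fix ν φ̂) Λ) (unfold ν φ̂)} → Refutes r →
              (η : Returns Λ) → ∀ w → current w ⇝* state (fix-ν r) η →
              ∀ {n X} (φ : Fml (suc n)) (σ : Fin n → Formula) (ρ : Vector (World → Set) n) →
              sub σ (fix ν φ) ≡ fix ν φ̂ → (∀ v → X v → ⟦ φ ⟧ (X ▹ ρ) v) →
              Canonical Λ (fix ν φ) σ → AllBound η (fix ν φ) σ ρ → ¬ X w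
  refutes-ν ih η w ms {X = X} φ σ ρ refl postfixed canonical bound Xw =
    ih (restrict (sub σ (fix ν φ)) η) w (ms ◅◅ (fix-ν ◅ ε)) φ (sub σ (fix ν φ) ▹ σ) (X ▹ ρ)
      (sym (unfold-sub ν φ σ)) (canonical-body unf {q = ν} refl canonical)
      (bound-body unf {q = ν} refl canonical bound
        (ν-bound φ σ ρ postfixed (λ occ χ∈ → canonical occ (proj₁ (∈-below⁻ (sub σ (fix ν φ)) _ χ∈)))
          (λ fr → bound-unfolding unf (free-fix-< σ fr) (bound fr))))
      (postfixed w Xw)
    where
    unf : Unfolding (sub σ (fix ν φ)) η (restrict (sub σ (fix ν φ)) η)
    unf = unfolding-restrict (sub σ (fix ν φ)) η

  -- Induction on the refutation, uniformly in world, reading and interpretation. Loops cause no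
  -- circularity: a return appeals to the interpretation of its variable.
  refutes : ∀ {Λ ψ} (r : Refutation Λ ψ) → Refutes r
  refutes (return φ∈) η w ms (var i) σ ρ eq canonical bound (lift h)
    with subst (λ ξ → Bound η ξ (ρ i)) eq (bound var)
  ... | μ-bound _ avoids = h (avoids φ∈ w (ms ◅◅ (return ◅ ε)))
  -- By canonicity a `μ`-formula that is spelt out never meets a `return`.
  refutes (return φ∈) η w ms (fix μ χ) σ ρ refl canonical bound h = canonical refl φ∈
  refutes (lit l) η w ms (var i) σ ρ eq canonical bound h = not-fix (bound var) eq λ ()
  refutes (lit l) η w ms (lit _) σ ρ refl canonical bound h = refutes-lit ms lit h
  refutes (⋀ γ∈ r) η w ms (var i) σ ρ eq canonical bound h = not-fix (bound var) eq λ ()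
  refutes (⋀ γ∈ r) η w ms (⋀ Γ) σ ρ refl canonical bound h with ∈-subs⁻ σ Γ γ∈
  ... | β , β∈ , eq = refutes r η w (ms ◅◅ (⋀ ◅ ε)) β σ ρ (sym eq)
    (λ occ → canonical (⋀ β∈ occ)) (λ fr → bound (⋀ β∈ fr)) (⟦⟧⋀-∈ β∈ h)
  refutes (⋁ c rs) η w ms (var i) σ ρ eq canonical bound h = not-fix (bound var) eq λ ()
  refutes (⋁ {Θ = Θ} c rs) η w ms (⋁ Γ) σ ρ refl canonical bound h = h λ h′ →
    let β , β∈ , hβ = ⟦⟧⋁-∈ h′ in
    element (CoCover.modal c (∈-subs⁺ σ β∈)) β refl (∈-subs⁺ σ β∈)
      (λ occ → canonical (⋁ β∈ occ)) (λ fr → bound (⋁ β∈ fr)) hβ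
    where
    element : ∀ {ξ} → Modal ξ → ∀ β → sub σ β ≡ ξ → ξ ∈ Θ → Canonical _ β σ → AllBound η β σ ρ →
              ¬ ⟦ β ⟧ ρ w
    element (lit l) (var i) eq ξ∈ canonical bound h = not-fix (bound var) eq λ ()
    element (lit l) (lit _) refl ξ∈ canonical bound h = refutes-lit ms (⋁ ξ∈) h
    element (□ γ) (var i) eq ξ∈ canonical bound h = not-fix (bound var) eq λ ()
    element (□ γ) (□ β) refl ξ∈ canonical bound h =
      refutes (rs ξ∈) η (child w ms (⋁ ξ∈)) ε β σ ρ refl
        (λ occ → canonical (□ occ)) (λ fr → bound (□ fr)) (h _ (edge ms (⋁ ξ∈)))
    element (◇ Δ) (var i) eq ξ∈ canonical bound h = not-fix (bound var) eq λ ()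
    element (◇ Δ) (◇ (var i)) eq ξ∈ canonical bound h = not-fix (bound (◇ var)) (◇-injective eq) λ ()
    element (◇ Δ) (◇ (⋀ Δ′)) refl ξ∈ canonical bound h = h λ (v , w⟶v , hv) → at-child w⟶v hv
      where
      at-child : ∀ {v} → w ⟶ v → ¬ ⟦ ⋀ Δ′ ⟧ ρ v
      -- The state that spawned the child is final, hence it is the disjunction at hand, and the
      -- child refutes one of its `□`-disjuncts.
      at-child (edge ms′ sp) hv with final-unique (spawns-final sp) (λ ()) ms′ ms
      at-child (edge ms′ (⋁ γ∈)) hv | refl with ∈-subs⁻ σ Δ′ (CoCover.bounded c ξ∈ γ∈)
      ... | δ , δ∈ , eq = refutes (rs γ∈) η (child w ms′ (⋁ γ∈)) ε δ σ ρ (sym eq)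
        (λ occ → canonical (◇ (⋀ δ∈ occ))) (λ fr → bound (◇ (⋀ δ∈ fr))) (⟦⟧⋀-∈ δ∈ hv)
  refutes (□ r) η w ms (var i) σ ρ eq canonical bound h = not-fix (bound var) eq λ ()
  refutes (□ r) η w ms (□ β) σ ρ refl canonical bound h =
    refutes r η (child w ms □) ε β σ ρ refl
      (λ occ → canonical (□ occ)) (λ fr → bound (□ fr)) (h _ (edge ms □))
  refutes (◇ γ) η w ms (var i) σ ρ eq canonical bound h = not-fix (bound var) eq λ ()
  refutes (◇ γ) η w ms (◇ β) σ ρ refl canonical bound h = h λ (v , w⟶v , _) → childless w⟶v
    where
    childless : ∀ {v} → ¬ (w ⟶ v)
    childless (edge ms′ sp) with final-unique (spawns-final sp) (λ ()) ms′ ms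
    childless (edge ms′ ()) | refl
  refutes (fix-μ φ∉ r) η w ms (var i) σ ρ eq canonical bound h
    with subst (λ ξ → Bound η ξ (ρ i)) eq (bound var)
  -- Conversely, a variable read as a `μ`-formula always has a return and never meets `fix-μ`.
  ... | μ-bound φ∈ _ = φ∉ φ∈
  refutes {Λ} (fix-μ φ∉ r) η w ms (fix μ φ) σ ρ refl canonical bound h =
    -- The least fixed point lies in every prefixed set, but `w` passes through `s` and so is
    -- outside `Avoiding`.
    h Avoiding prefixed λ avoiding → avoiding ms
    where
    s : State
    s = state (fix-μ φ∉ r) η

    Avoiding : World → Set
    Avoiding v = ¬ (current v ⇝* s)

    unf : Unfolding (sub σ (fix μ φ)) η (push s (restrict (sub σ (fix μ φ)) η))
    unf = unfolding-push η

    -- An older return to the same body would have to be less complex than itself to survive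
    -- `below`.
    avoids : ∀ φ∈ v → current v ⇝* push s (restrict (sub σ (fix μ φ)) η) _ φ∈ → ¬ Avoiding v
    avoids (here _)   v ms′ avoiding = avoiding ms′
    avoids (there φ∈) v ms′ avoiding = <-irrefl refl (proj₂ (∈-below⁻ (sub σ (fix μ φ)) Λ φ∈))

    prefixed : ∀ v → ⟦ φ ⟧ (Avoiding ▹ ρ) v → ¬ ¬ Avoiding v
    prefixed v hφ k = k λ ms′ → refutes r (push s (restrict (sub σ (fix μ φ)) η)) v (ms′ ◅◅ (fix-μ ◅ ε))
      φ (sub σ (fix μ φ) ▹ σ) (Avoiding ▹ ρ) (sym (unfold-sub μ φ σ))
      (canonical-body unf {q = μ} refl canonical)
      (bound-body unf {q = μ} refl canonical bound (μ-bound (here refl) avoids))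
      hφ
  refutes (fix-ν r) η w ms (var i) σ ρ eq canonical bound (lift h)
    with subst (λ ξ → Bound η ξ (ρ i)) eq (bound var)
  ... | ν-bound φ σ′ ρ′ postfixed canonical′ bound′ =
    h (refutes-ν (refutes r) η w ms φ σ′ ρ′ refl postfixed canonical′ bound′)
  refutes (fix-ν r) η w ms (fix ν φ) σ ρ refl canonical bound h = h λ (X , postfixed , Xw) →
    refutes-ν (refutes r) η w ms φ σ ρ refl postfixed canonical bound Xw

  refuted : ¬ ⟦ α ⟧ ∅ origin
  refuted = refutes r₀ (λ _ ()) origin ε α (λ ()) ∅ (sub-id (λ ()) α) (λ _ ()) λ { {()} }

theorem4p8 : (α : Formula) → Valid α → Conjunctive α → [] ⊩ α
theorem4p8 α valid conjunctive with evaluate [] α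
... | inj₁ p = provable⇒⊩ p
... | inj₂ r = ⊥-elim
  (cyclic conjunctive {Λ = []} (λ ()) r (λ ()) (λ { {()} })
    (subst (λ β → Subformula β α) (sym closed) ε)
    λ r′ → Countermodel.refuted (subst (Refutation []) closed r′) (valid _))
  where
  closed : sub (λ ()) α ≡ α
  closed = sub-id (λ ()) α
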